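{- Let $S$ be a nonempty set and let $\mathbb D_S$ be the free convex algebra over $S$, i.e. the convex algebra of finitely supported probability distributions on $S$, with carrier $\mathcal D_f S$. Let $*\notin \mathcal D_f S$. One-point extensions of $\mathbb D_S$, with carrier $\mathcal D_f S\cup\{*\}$, can be constructed as follows: (1) the black-hole behaviour, where the set of adherence equals $\mathcal D_f S$: $p\xi+\bar p*=*$ for all $\xi\in\mathcal D_f S$ and $p\in(0,1)$; (2) let $w\in\mathcal D_f S$, and let $*$ imitate $w$ on all of $\mathcal D_f S$: $p\xi+\bar p*=p\xi+\bar p w$ for all $\xi\in\mathcal D_f S$ and $p\in(0,1)$; (3) let $w$ be an extremal point of $\mathbb D_S$, and let $*$ imitate $w$ on $\mathcal D_f S\setminus\{w\}$ and adhere $w$: $p\xi+\bar p*=p\xi+\bar p w$ for all $\xi\in\mathcal D_f S\setminus\{w\}$ and $p\in(0,1)$, and $pw+\bar p*=*$ for all $p\in(0,1)$. Every one-point extension of $\mathbb D_S$ can be obtained in this way, and each two of these extensions are different.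
   Context: For $p\in[0,1]$ write $\bar p=1-p$. A convex algebra $\mathbb X$ is a set $X$ with an operation $(x_0,\dots,x_n)\mapsto\sum_{i=0}^n p_ix_i$ for every $n\in\mathbb N$ and all $p_0,\dots,p_n\in[0,1]$ with $\sum_i p_i=1$, such that (Projection) $\sum_i p_ix_i=x_j$ if $p_j=1$, and (Barycenter) $\sum_{i=0}^n p_i\big(\sum_{j=0}^m q_{i,j}x_j\big)=\sum_{j=0}^m\big(\sum_{i=0}^n p_iq_{i,j}\big)x_j$. A convex algebra is determined by its binary operations $px+\bar py$, $p\in(0,1)$. A one-point extension of a convex algebra $\mathbb X$ is a convex algebra $\mathbb X_*$ with carrier $X\cup\{*\}$, $*\notin X$, whose operations restricted to $X$ are those of $\mathbb X$; it is determined by the elements $px+\bar p*$ for $x\in X$, $p\in(0,1)$. Its set of adherence is the set of all $x\in X$ with $px+\bar p*=*$ for all $p\in(0,1)$. $\mathcal D_fS$ is the set of finitely supported probability distributions on $S$; $\mathbb D_S$ carries the pointwise convex combinations (as a convex subset of the vector space of real-valued functions on $S$). A point $z$ of a convex algebra is extremal if $px+\bar py=z$ with $p\in(0,1)$ implies $x=y=z$.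
   Formalization: When S has exactly one element, (1) and (3) prescribe the same extension, so "each two of these extensions are different" fails there; this single pair is exempted from the distinctness claim. -}

module Defs where

open import Algebra.Bundles using (CommutativeRing)
open import Axiom.ExcludedMiddle using (ExcludedMiddle)
open import Data.Fin.Base using (Fin; zero; suc; punchIn; punchOut)
open import Data.Fin.Properties using (punchInᵢ≢i; punchIn-punchOut)
open import Data.List.Base using (List; []; _∷_; concat; tabulate; lookup; deduplicate)
open import Data.List.Membership.Propositional using (_∉_)
open import Data.List.Membership.Propositional.Properties
  using (∈-concat⁺′; ∈-tabulate⁺; ∈-deduplicate⁺)
open import Data.List.Relation.Unary.Any using (here; there)
open import Data.List.Relation.Unary.AllPairs using (_∷_)
open import Data.List.Relation.Unary.Unique.Propositional using (Unique)
open import Data.List.Relation.Unary.Unique.Propositional.Properties using (Unique[x∷xs]⇒x∉xs)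
import Data.List.Relation.Unary.Unique.DecPropositional.Properties as UniqueDec
open import Data.Maybe.Base using (Maybe; just; nothing)
open import Data.Maybe.Relation.Binary.Pointwise using (Pointwise)
open import Data.Nat.Base using (ℕ; zero; suc)
open import Data.Product.Base using (∃; _×_; _,_; proj₁; proj₂)
import Data.Vec.Functional as Vector
open import Function.Base using (_∘_)
open import Level using (0ℓ; _⊔_) renaming (suc to ℓsuc)
open import Relation.Binary.Core using (Rel)
open import Relation.Binary.Definitions using (DecidableEquality)
open import Relation.Binary.PropositionalEquality using (_≡_; _≢_)
  renaming (refl to ≡-refl; sym to ≡-sym; subst to ≡-subst)
open import Relation.Binary.Structures using (IsEquivalence; IsTotalOrder)
open import Relation.Nullary using (¬_; yes; no; contradiction)
import Algebra.Properties.Semiring.Sum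
import Relation.Binary.Reasoning.Setoid

-- The library has no real numbers, so everything is parametrised by a complete
-- ordered field; classically ℝ is, up to isomorphism, the only one.
record CompleteOrderedField : Set₁ where
  infix 4 _≤_ _<_
  field
    commutativeRing : CommutativeRing 0ℓ 0ℓ

  open CommutativeRing commutativeRing public hiding (zero)

  field
    0≉1            : ¬ 0# ≈ 1#
    inverse        : ∀ x → ¬ x ≈ 0# → ∃ λ y → x * y ≈ 1#
    _≤_            : Rel Carrier 0ℓ
    ≤-isTotalOrder : IsTotalOrder _≈_ _≤_
    +-monoˡ-≤      : ∀ z {x y} → x ≤ y → x + z ≤ y + z
    *-nonNeg       : ∀ {x y} → 0# ≤ x → 0# ≤ y → 0# ≤ x * y

  UpperBound : (Carrier → Set) → Carrier → Set
  UpperBound P u = ∀ x → P x → x ≤ u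

  field
    supremum : ∀ (P : Carrier → Set) → ∃ P → ∃ (UpperBound P) →
               ∃ λ s → UpperBound P s × (∀ u → UpperBound P u → s ≤ u)

  _<_ : Rel Carrier 0ℓ
  x < y = x ≤ y × ¬ x ≈ y

  open Algebra.Properties.Semiring.Sum semiring public
    using (sum; sum-cong-≋; sum-replicate-zero; sum-remove; ∑-comm; *-distribˡ-sum; *-distribʳ-sum)
  open IsTotalOrder ≤-isTotalOrder public using ()
    renaming (refl to ≤-refl; trans to ≤-trans; antisym to ≤-antisym; ≤-respˡ-≈ to ≤-respˡ;
              ≤-respʳ-≈ to ≤-respʳ; reflexive to ≤-reflexive; total to ≤-total)

  +-mono-≤ : ∀ {x y u v} → x ≤ y → u ≤ v → x + u ≤ y + v
  +-mono-≤ {x} {y} {u} {v} x≤y u≤v =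
    ≤-trans (+-monoˡ-≤ u x≤y)
            (≤-respˡ (+-comm u y) (≤-respʳ (+-comm v y) (+-monoˡ-≤ y u≤v)))

  0≤y-x : ∀ {x y} → x ≤ y → 0# ≤ y - x
  0≤y-x {x} x≤y = ≤-respˡ (-‿inverseʳ x) (+-monoˡ-≤ (- x) x≤y)

  y-x+x : ∀ x y → (y - x) + x ≈ y
  y-x+x x y = trans (+-assoc y (- x) x) (trans (+-congˡ (-‿inverseˡ x)) (+-identityʳ y))

  x+[y-x] : ∀ x y → x + (y - x) ≈ y
  x+[y-x] x y = trans (+-comm x (y - x)) (y-x+x x y)

  y-x≤y : ∀ {x y} → 0# ≤ x → y - x ≤ y
  y-x≤y {x} {y} 0≤x =
    ≤-respˡ (+-identityʳ _) (≤-respʳ (y-x+x x y) (+-mono-≤ ≤-refl 0≤x))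

  *-monoʳ-≤1 : ∀ {x y} → 0# ≤ x → y ≤ 1# → x * y ≤ x
  *-monoʳ-≤1 {x} {y} 0≤x y≤1 =
    ≤-respˡ (+-identityˡ _)
      (≤-respʳ (trans (sym (distribˡ x (1# - y) y)) (trans (*-congˡ (y-x+x y 1#)) (*-identityʳ x)))
        (+-monoˡ-≤ (x * y) (*-nonNeg 0≤x (0≤y-x y≤1))))

  sum-mono : ∀ {n} {f g : Fin n → Carrier} → (∀ i → f i ≤ g i) → sum f ≤ sum g
  sum-mono {zero}  h = ≤-refl
  sum-mono {suc n} h = +-mono-≤ (h zero) (sum-mono (h ∘ suc))

  sum-zero : ∀ {n} {f : Fin n → Carrier} → (∀ i → f i ≈ 0#) → sum f ≈ 0#
  sum-zero {n} h = trans (sum-cong-≋ h) (sum-replicate-zero n)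

  sum-nonNeg : ∀ {n} {f : Fin n → Carrier} → (∀ i → 0# ≤ f i) → 0# ≤ sum f
  sum-nonNeg {n} h = ≤-respˡ (sum-replicate-zero n) (sum-mono h)

  term≤sum : ∀ {n} {f : Fin n → Carrier} → (∀ i → 0# ≤ f i) → ∀ i → f i ≤ sum f
  term≤sum {suc n} {f} h i =
    ≤-respˡ (+-identityʳ _)
      (≤-respʳ (sym (sum-remove {i = i} f)) (+-mono-≤ ≤-refl (sum-nonNeg (h ∘ punchIn i))))

  sum-single : ∀ {n} {f : Fin n → Carrier} i → (∀ j → j ≢ i → f j ≈ 0#) → sum f ≈ f i
  sum-single {suc n} {f} i h =
    trans (sum-remove {i = i} f)
      (trans (+-congˡ (sum-zero (λ j → h (punchIn i j) (punchInᵢ≢i i j)))) (+-identityʳ _))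

------------------------------------------------------------------------

module Convexity (ℝ : CompleteOrderedField) where
  open CompleteOrderedField ℝ

  record Weights (n : ℕ) : Set where
    field
      weight : Fin (suc n) → Carrier
      0≤     : ∀ i → 0# ≤ weight i
      ≤1     : ∀ i → weight i ≤ 1#
      total  : sum weight ≈ 1#
  open Weights public

  mix : ∀ {n m} → Weights n → (Fin (suc n) → Weights m) → Weights m
  mix {n} {m} p q = record
    { weight = r
    ; 0≤     = λ j → sum-nonNeg (λ i → *-nonNeg (0≤ p i) (0≤ (q i) j))
    ; ≤1     = λ j → ≤-trans (sum-mono {g = weight p} (λ i → *-monoʳ-≤1 (0≤ p i) (≤1 (q i) j)))
                             (≤-reflexive (total p))
    ; total  = begin
        sum r
          ≈⟨ ∑-comm (λ j i → weight p i * weight (q i) j) ⟩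
        sum (λ i → sum (λ j → weight p i * weight (q i) j))
          ≈⟨ sum-cong-≋ (λ i → sym (*-distribˡ-sum (weight p i) (weight (q i)))) ⟩
        sum (λ i → weight p i * sum (weight (q i)))
          ≈⟨ sum-cong-≋ (λ i → trans (*-congˡ {weight p i} (total (q i))) (*-identityʳ (weight p i))) ⟩
        sum (weight p)
          ≈⟨ total p ⟩
        1# ∎
    }
    where
    open Relation.Binary.Reasoning.Setoid setoid
    r : Fin (suc m) → Carrier
    r j = sum (λ i → weight p i * weight (q i) j)

  weight≈0 : ∀ {n} (p : Weights n) {i j} → weight p j ≈ 1# → i ≢ j → weight p i ≈ 0#
  weight≈0 p {i} {j} pj≈1 i≢j = ≤-antisym pᵢ≤0 (0≤ p i)
    where
    rest : Carrier
    rest = sum (weight p ∘ punchIn j)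

    1+rest≈1 : 1# + rest ≈ 1#
    1+rest≈1 = trans (+-congʳ (sym pj≈1)) (trans (sym (sum-remove {i = j} (weight p))) (total p))

    rest≈0 : rest ≈ 0#
    rest≈0 = trans (sym (+-identityˡ rest)) (trans (+-congʳ (sym (-‿inverseˡ 1#)))
               (trans (+-assoc (- 1#) 1# rest) (trans (+-congˡ 1+rest≈1) (-‿inverseˡ 1#))))

    j≢i : j ≢ i
    j≢i j≡i = i≢j (≡-sym j≡i)

    pᵢ≤0 : weight p i ≤ 0#
    pᵢ≤0 = ≤-respʳ rest≈0
      (≡-subst (λ k → weight p k ≤ rest) (punchIn-punchOut j≢i)
        (term≤sum (0≤ p ∘ punchIn j) (punchOut j≢i)))

  record OpenUnit : Set where
    field
      value : Carrier
      0<    : 0# < value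
      <1    : value < 1#
  open OpenUnit public

  pair : OpenUnit → Weights 1
  pair p = record
    { weight = value p Vector.∷ (1# - value p) Vector.∷ Vector.[]
    ; 0≤     = λ { zero → proj₁ (0< p) ; (suc zero) → 0≤y-x (proj₁ (<1 p)) }
    ; ≤1     = λ { zero → proj₁ (<1 p) ; (suc zero) → y-x≤y (proj₁ (0< p)) }
    ; total  = trans (+-congˡ (+-identityʳ _)) (x+[y-x] (value p) 1#)
    }

  Combination : ∀ {c} → Set c → Set c
  Combination X = ∀ {n} → Weights n → (Fin (suc n) → X) → X

  binary : ∀ {c} {X : Set c} → Combination X → OpenUnit → X → X → X
  binary combine p x y = combine (pair p) (x Vector.∷ y Vector.∷ Vector.[])

  record IsConvexAlgebra {c ℓ} {X : Set c} (_≃_ : Rel X ℓ) (combine : Combination X)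
         : Set (c ⊔ ℓ) where
    field
      isEquivalence : IsEquivalence _≃_
      cong          : ∀ {n} {p q : Weights n} {x y : Fin (suc n) → X} →
                      (∀ i → weight p i ≈ weight q i) → (∀ i → x i ≃ y i) →
                      combine p x ≃ combine q y
      projection    : ∀ {n} (p : Weights n) (x : Fin (suc n) → X) j →
                      weight p j ≈ 1# → combine p x ≃ x j
      barycenter    : ∀ {n m} (p : Weights n) (q : Fin (suc n) → Weights m)
                      (x : Fin (suc m) → X) →
                      combine p (λ i → combine (q i) x) ≃ combine (mix p q) x

  record ConvexAlgebra c ℓ : Set (ℓsuc (c ⊔ ℓ)) where
    infix 4 _≃_
    field
      Point           : Set c
      _≃_             : Rel Point ℓ
      combine         : Combination Point
      isConvexAlgebra : IsConvexAlgebra _≃_ combine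

  Extremal : ∀ {c ℓ} (𝕏 : ConvexAlgebra c ℓ) → ConvexAlgebra.Point 𝕏 → Set (c ⊔ ℓ)
  Extremal 𝕏 z = ∀ p x y → binary combine p x y ≃ z → x ≃ z × y ≃ z
    where open ConvexAlgebra 𝕏

  pattern ⋆ = nothing

  module _ {c ℓ} (𝕏 : ConvexAlgebra c ℓ) where
    open ConvexAlgebra 𝕏

    infix 4 _≃*_
    _≃*_ : Rel (Maybe Point) (c ⊔ ℓ)
    _≃*_ = Pointwise _≃_

    record OnePointExtension : Set (c ⊔ ℓ) where
      field
        combine*         : Combination (Maybe Point)
        isConvexAlgebra* : IsConvexAlgebra _≃*_ combine*
        restricts        : ∀ {n} (p : Weights n) (x : Fin (suc n) → Point) →
                          combine* p (just ∘ x) ≃* just (combine p x)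

  module _ {c ℓ} {𝕏 : ConvexAlgebra c ℓ} where
    open ConvexAlgebra 𝕏
    open OnePointExtension

    infix 4 _≅_
    -- Equality of algebras on the common carrier, not isomorphism.
    _≅_ : Rel (OnePointExtension 𝕏) (c ⊔ ℓ)
    E ≅ F = ∀ {n} (p : Weights n) x → _≃*_ 𝕏 (combine* E p x) (combine* F p x)

    ImitatesAt : OnePointExtension 𝕏 → Point → Point → Set (c ⊔ ℓ)
    ImitatesAt E w x =
      ∀ p → _≃*_ 𝕏 (binary (combine* E) p (just x) ⋆) (just (binary combine p x w))

    Adherent : OnePointExtension 𝕏 → Point → Set (c ⊔ ℓ)
    Adherent E x = ∀ p → _≃*_ 𝕏 (binary (combine* E) p (just x) ⋆) ⋆

------------------------------------------------------------------------

-- Excluded middle serves to merge supports without repetition.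
module FreeConvexAlgebra {a} (em : ExcludedMiddle a) (ℝ : CompleteOrderedField) (S : Set a) where
  open CompleteOrderedField ℝ
  open Convexity ℝ

  sumOver : List S → (S → Carrier) → Carrier
  sumOver xs f = sum (λ i → f (lookup xs i))

  -- `cover` contains the support, possibly strictly.
  record Distribution : Set a where
    field
      mass    : S → Carrier
      nonNeg  : ∀ s → 0# ≤ mass s
      cover   : List S
      unique  : Unique cover
      outside : ∀ {s} → s ∉ cover → mass s ≈ 0#
      total-1 : sumOver cover mass ≈ 1#
  open Distribution public

  infix 4 _≐_
  _≐_ : Rel Distribution a
  μ ≐ ν = ∀ s → mass μ s ≈ mass ν s

  private
    _≟_ : DecidableEquality S
    x ≟ y = em

    indicator : S → S → Carrier
    indicator s t with s ≟ t
    ... | yes _ = 1#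
    ... | no  _ = 0#

    indicator-sift : ∀ (f : S → Carrier) xs → Unique xs → ∀ s → (s ∉ xs → f s ≈ 0#) →
                     sumOver xs (λ t → indicator s t * f t) ≈ f s
    indicator-sift f [] _ s out = sym (out (λ ()))
    indicator-sift f (x ∷ xs) u@(_ ∷ u′) s out with s ≟ x
    ... | yes ≡-refl = trans (+-cong (*-identityˡ _) (absent xs (Unique[x∷xs]⇒x∉xs u)))
                             (+-identityʳ _)
      where
      absent : ∀ ys → s ∉ ys → sumOver ys (λ t → indicator s t * f t) ≈ 0#
      absent []       _ = refl
      absent (y ∷ ys) s∉ with s ≟ y
      ... | yes s≡y = contradiction (here s≡y) s∉
      ... | no  _   = trans (+-cong (zeroˡ _) (absent ys (s∉ ∘ there))) (+-identityˡ _)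
    ... | no s≢x = trans (+-cong (zeroˡ _) (indicator-sift f xs u′ s out′)) (+-identityˡ _)
      where
      out′ : s ∉ xs → f s ≈ 0#
      out′ s∉ = out λ { (here s≡x) → s≢x s≡x ; (there s∈) → s∉ s∈ }

  sumOver-cover : ∀ (f : S → Carrier) xs ys → Unique xs → Unique ys →
                  (∀ {s} → s ∉ xs → f s ≈ 0#) → (∀ {s} → s ∉ ys → f s ≈ 0#) →
                  sumOver xs f ≈ sumOver ys f
  sumOver-cover f xs ys uxs uys outx outy = begin
    sumOver xs f
      ≈⟨ sum-cong-≋ (λ i → sym (indicator-sift f ys uys (lookup xs i) outy)) ⟩
    sumOver xs (λ s → sumOver ys (λ t → indicator s t * f t))
      ≈⟨ ∑-comm (λ i j → indicator (lookup xs i) (lookup ys j) * f (lookup ys j)) ⟩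
    sumOver ys (λ t → sumOver xs (λ s → indicator s t * f t))
      ≈⟨ sum-cong-≋ (λ j → step (lookup ys j)) ⟩
    sumOver ys f ∎
    where
    open Relation.Binary.Reasoning.Setoid setoid

    swap : ∀ s t → indicator s t * f t ≈ indicator t s * f s
    swap s t with s ≟ t | t ≟ s
    ... | yes ≡-refl | yes _   = refl
    ... | no _       | no _    = trans (zeroˡ _) (sym (zeroˡ _))
    ... | yes s≡t    | no t≢s  = contradiction (≡-sym s≡t) t≢s
    ... | no s≢t     | yes t≡s = contradiction (≡-sym t≡s) s≢t

    step : ∀ t → sumOver xs (λ s → indicator s t * f t) ≈ f t
    step t = trans (sum-cong-≋ (λ i → swap (lookup xs i) t)) (indicator-sift f xs uxs t outx)

  combineD : Combination Distribution
  combineD {n} p μ = record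
    { mass    = m
    ; nonNeg  = λ s → sum-nonNeg (λ i → *-nonNeg (0≤ p i) (nonNeg (μ i) s))
    ; cover   = xs
    ; unique  = uxs
    ; outside = λ s∉ → sum-zero (λ i → trans (*-congˡ {weight p i} (out i s∉)) (zeroʳ (weight p i)))
    ; total-1 = begin
        sumOver xs m
          ≈⟨ ∑-comm (λ k i → weight p i * mass (μ i) (lookup xs k)) ⟩
        sum (λ i → sumOver xs (λ s → weight p i * mass (μ i) s))
          ≈⟨ sum-cong-≋ (λ i → sym (*-distribˡ-sum (weight p i) (mass (μ i) ∘ lookup xs))) ⟩
        sum (λ i → weight p i * sumOver xs (mass (μ i)))
          ≈⟨ sum-cong-≋ (λ i → *-congˡ {weight p i} (trans
               (sumOver-cover (mass (μ i)) xs (cover (μ i)) uxs (unique (μ i)) (out i) (outside (μ i)))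
               (total-1 (μ i)))) ⟩
        sum (λ i → weight p i * 1#)
          ≈⟨ sum-cong-≋ (λ i → *-identityʳ (weight p i)) ⟩
        sum (weight p)
          ≈⟨ total p ⟩
        1# ∎
    }
    where
    open Relation.Binary.Reasoning.Setoid setoid

    m : S → Carrier
    m s = sum (λ i → weight p i * mass (μ i) s)

    all xs : List S
    all = concat (tabulate (cover ∘ μ))
    xs  = deduplicate _≟_ all

    uxs : Unique xs
    uxs = UniqueDec.deduplicate-! _≟_ all

    out : ∀ i {s} → s ∉ xs → mass (μ i) s ≈ 0#
    out i s∉ = outside (μ i) λ s∈ →
      s∉ (∈-deduplicate⁺ _≟_ (∈-concat⁺′ s∈ (∈-tabulate⁺ {f = cover ∘ μ} i)))

  𝔻 : ConvexAlgebra a a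
  𝔻 = record
    { Point           = Distribution
    ; _≃_             = _≐_
    ; combine         = combineD
    ; isConvexAlgebra = record
      { isEquivalence = record
        { refl  = λ s → refl
        ; sym   = λ h s → sym (h s)
        ; trans = λ h k s → trans (h s) (k s)
        }
      ; cong       = λ p≈q x≐y s → sum-cong-≋ (λ i → *-cong (p≈q i) (x≐y i s))
      ; projection = λ p x j pj≈1 s →
          trans (sum-single j (λ i i≢j → trans (*-congʳ {mass (x i) s} (weight≈0 p pj≈1 i≢j)) (zeroˡ (mass (x i) s))))
                (trans (*-congʳ pj≈1) (*-identityˡ _))
      ; barycenter = bary
      }
    }
    where
    bary : ∀ {n m} (p : Weights n) (q : Fin (suc n) → Weights m) (x : Fin (suc m) → Distribution) →
           combineD p (λ i → combineD (q i) x) ≐ combineD (mix p q) x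
    bary p q x s = begin
      sum (λ i → weight p i * sum (λ j → weight (q i) j * mass (x j) s))
        ≈⟨ sum-cong-≋ (λ i → *-distribˡ-sum (weight p i) (λ j → weight (q i) j * mass (x j) s)) ⟩
      sum (λ i → sum (λ j → weight p i * (weight (q i) j * mass (x j) s)))
        ≈⟨ ∑-comm (λ i j → weight p i * (weight (q i) j * mass (x j) s)) ⟩
      sum (λ j → sum (λ i → weight p i * (weight (q i) j * mass (x j) s)))
        ≈⟨ sum-cong-≋ (λ j → sum-cong-≋ (λ i → sym (*-assoc (weight p i) (weight (q i) j) (mass (x j) s)))) ⟩
      sum (λ j → sum (λ i → weight p i * weight (q i) j * mass (x j) s))
        ≈⟨ sum-cong-≋ (λ j → sym (*-distribʳ-sum (mass (x j) s) (λ i → weight p i * weight (q i) j))) ⟩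
      sum (λ j → sum (λ i → weight p i * weight (q i) j) * mass (x j) s) ∎
      where open Relation.Binary.Reasoning.Setoid setoid

  data Behaviour : Set a where
    blackHole       : Behaviour
    imitate         : Distribution → Behaviour
    imitateAdhering : (w : Distribution) → Extremal 𝔻 w → Behaviour

  _Follows_ : OnePointExtension 𝔻 → Behaviour → Set a
  E Follows blackHole             = ∀ ξ → Adherent E ξ
  E Follows (imitate w)           = ∀ ξ → ImitatesAt E w ξ
  E Follows (imitateAdhering w _) = (∀ ξ → ¬ ξ ≐ w → ImitatesAt E w ξ) × Adherent E w

  infix 4 _≈ᵇ_
  data _≈ᵇ_ : Rel Behaviour a where
    blackHole       : blackHole ≈ᵇ blackHole
    imitate         : ∀ {v w} → v ≐ w → imitate v ≈ᵇ imitate w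
    imitateAdhering : ∀ {v w ev ew} → v ≐ w → imitateAdhering v ev ≈ᵇ imitateAdhering w ew

  -- If S has only one element, its point mass w is the only distribution, and both
  -- `blackHole` and `imitateAdhering w` say exactly that w is adherent.
  data Coincide : Rel Behaviour a where
    left  : ∀ {w ew} → (∀ (s t : S) → s ≡ t) → Coincide blackHole (imitateAdhering w ew)
    right : ∀ {w ew} → (∀ (s t : S) → s ≡ t) → Coincide (imitateAdhering w ew) blackHole

-- In an extension E, once p ξ + p̄ * = * for one p, the Archimedean property gives it for all p.
-- If ξ is not adherent, then p ↦ p ξ + p̄ * is an affine path in 𝒟_f S, hence of the form p ξ + p̄ w
-- with w its extrapolation to p = 0, and w is a distribution since nonnegativity passes to the limit.
-- Reading ⅓ ξ + ⅔ (½ η + ½ *) = ⅓ η + ⅔ (½ ξ + ½ *) for two non-adherent points shows that w does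
-- not depend on ξ, and for an adherent ξ and a non-adherent η that ξ = w. Finally the set of
-- adherence is a face, so if it is {w} then w is extremal.
--
-- Conversely, let A be a convex face with A = 𝒟_f S or A ⊆ {w}. A combination in which * occurs is
-- set to * if all points of its support lie in A ∪ {*}, and otherwise is computed with w in place
-- of *; A = 𝒟_f S, ∅, {w} gives the three constructions.

module Submission where

open import Defs
open import Axiom.ExcludedMiddle using (ExcludedMiddle)
open import Data.Bool.Base using (Bool; true; false; not; if_then_else_)
open import Data.Bool.Properties using (not-injective)
open import Data.Empty.Polymorphic using (⊥)
open import Data.Fin.Base using (Fin; zero; suc)
open import Data.Fin.Patterns using (0F; 1F; 2F)
import Data.Fin.Properties as Fin
open import Data.List.Base as List using (lookup)
open import Data.List.Membership.Propositional using (_∉_)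
import Data.List.Relation.Unary.All as ListAll
import Data.List.Relation.Unary.AllPairs as AllPairs
open import Data.List.Relation.Unary.Any using (here)
open import Data.Maybe.Base using (Maybe; just; nothing; fromMaybe; is-just)
open import Data.Maybe.Relation.Binary.Pointwise as Pointwise using (Pointwise; just; nothing)
open import Data.Maybe.Relation.Unary.All as All using (All; just; nothing)
open import Data.Nat.Base using (ℕ; zero; suc)
open import Data.Product.Base using (∃; _×_; _,_; proj₁; proj₂)
open import Data.Sum.Base using (_⊎_; inj₁; inj₂)
open import Data.Unit.Polymorphic using (⊤; tt)
open import Data.Vec.Functional using ([]; _∷_)
open import Function.Base using (_∘_; const; id)
open import Level using (Lift; lift; lower) renaming (suc to ℓsuc)
open import Relation.Binary.Core using (Rel)
open import Relation.Binary.PropositionalEquality using (_≡_; _≢_)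
  renaming (refl to ≡-refl; sym to ≡-sym; trans to ≡-trans; subst to ≡-subst; cong to ≡-cong)
open import Relation.Binary.Structures using (IsEquivalence)
open import Relation.Nullary using (¬_; Dec; yes; no; does; contradiction)
import Relation.Nullary.Decidable as Dec
import Algebra.Properties.CommutativeMonoid.Sum
import Algebra.Properties.Ring
import Algebra.Solver.Ring.NaturalCoefficients.Default
import Relation.Binary.Reasoning.Setoid

-- Order arithmetic and weights strictly between zero and one.

module OrderedFieldProperties {a} (em : ExcludedMiddle a) (ℝ : CompleteOrderedField) where
  open CompleteOrderedField ℝ
  open Convexity ℝ
  open Algebra.Properties.Ring ring using (+-cancelˡ; +-cancelʳ; -‿involutive; -1*x≈-x)
  open Algebra.Solver.Ring.NaturalCoefficients.Default commutativeSemiring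
    using (solve; _:=_; _:+_; _:*_; con)
  open Relation.Binary.Reasoning.Setoid setoid

  -- Excluded middle is given at level `a`, while statements about the field live at level zero;
  -- `Lift` bridges the two.
  decide : (P : Set) → Dec P
  decide P = Dec.map′ lower lift (em {Lift a P})

  _≈?_ : ∀ x y → Dec (x ≈ y)
  x ≈? y = decide (x ≈ y)

  <⇒≱ : ∀ {x y} → x < y → ¬ y ≤ x
  <⇒≱ (x≤y , x≉y) y≤x = x≉y (≤-antisym x≤y y≤x)

  compare : ∀ x y → x < y ⊎ x ≈ y ⊎ y < x
  compare x y with x ≈? y | ≤-total x y
  ... | yes x≈y | _        = inj₂ (inj₁ x≈y)
  ... | no  x≉y | inj₁ x≤y = inj₁ (x≤y , x≉y)
  ... | no  x≉y | inj₂ y≤x = inj₂ (inj₂ (y≤x , x≉y ∘ sym))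

  ≮⇒≥ : ∀ {x y} → ¬ x < y → y ≤ x
  ≮⇒≥ {x} {y} x≮y with compare x y
  ... | inj₁ x<y             = contradiction x<y x≮y
  ... | inj₂ (inj₁ x≈y)      = ≤-reflexive (sym x≈y)
  ... | inj₂ (inj₂ (y≤x , _)) = y≤x

  neg-mono-≤ : ∀ {x y} → x ≤ y → - y ≤ - x
  neg-mono-≤ {x} {y} x≤y = ≤-respˡ left (≤-respʳ right (+-monoˡ-≤ (- x + - y) x≤y))
    where
    left : x + (- x + - y) ≈ - y
    left = trans (sym (+-assoc x (- x) (- y))) (trans (+-congʳ (-‿inverseʳ x)) (+-identityˡ (- y)))
    right : y + (- x + - y) ≈ - x
    right = trans (+-congˡ (+-comm (- x) (- y))) (trans (sym (+-assoc y (- y) (- x)))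
              (trans (+-congʳ (-‿inverseʳ y)) (+-identityˡ (- x))))

  0≤-x : ∀ {x} → x ≤ 0# → 0# ≤ - x
  0≤-x {x} x≤0 = ≤-respʳ (+-identityˡ (- x)) (0≤y-x x≤0)

  0<1 : 0# < 1#
  0<1 with ≤-total 0# 1#
  ... | inj₁ 0≤1 = 0≤1 , 0≉1
  ... | inj₂ 1≤0 = ≤-respʳ square (*-nonNeg (0≤-x 1≤0) (0≤-x 1≤0)) , 0≉1
    where
    square : - 1# * - 1# ≈ 1#
    square = trans (-1*x≈-x (- 1#)) (-‿involutive 1#)

  *-cancelˡ : ∀ {c x y} → c ≉ 0# → c * x ≈ c * y → x ≈ y
  *-cancelˡ {c} {x} {y} c≉0 cx≈cy with inverse c c≉0
  ... | d , cd≈1 = trans (sym (undo x)) (trans (*-congˡ cx≈cy) (undo y))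
    where
    undo : ∀ z → d * (c * z) ≈ z
    undo z = trans (sym (*-assoc d c z))
               (trans (*-congʳ (trans (*-comm d c) cd≈1)) (*-identityˡ z))

  *≉0 : ∀ {x y} → x ≉ 0# → y ≉ 0# → x * y ≉ 0#
  *≉0 x≉0 y≉0 xy≈0 = y≉0 (*-cancelˡ x≉0 (trans xy≈0 (sym (zeroʳ _))))

  *-pos : ∀ {x y} → 0# < x → 0# < y → 0# < x * y
  *-pos (0≤x , 0≉x) (0≤y , 0≉y) = *-nonNeg 0≤x 0≤y , *≉0 (0≉x ∘ sym) (0≉y ∘ sym) ∘ sym

  *-monoˡ-≤ : ∀ {c x y} → 0# ≤ c → x ≤ y → c * x ≤ c * y
  *-monoˡ-≤ {c} {x} {y} 0≤c x≤y =
    ≤-respˡ (+-identityˡ _) (≤-respʳ eq (+-monoˡ-≤ (c * x) (*-nonNeg 0≤c (0≤y-x x≤y))))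
    where
    eq : c * (y - x) + c * x ≈ c * y
    eq = trans (sym (distribˡ c (y - x) x)) (*-congˡ (y-x+x x y))

  +-monoˡ-< : ∀ z {x y} → x < y → x + z < y + z
  +-monoˡ-< z {x} {y} (x≤y , x≉y) = +-monoˡ-≤ z x≤y , x≉y ∘ +-cancelʳ z x y

  x<x+y : ∀ x {y} → 0# < y → x < x + y
  x<x+y x {y} 0<y = ≤-respˡ (+-identityˡ x) (≤-respʳ (+-comm y x) (proj₁ 0+x<y+x))
                  , λ x≈x+y → proj₂ 0+x<y+x (trans (+-identityˡ x) (trans x≈x+y (+-comm x y)))
    where
    0+x<y+x : 0# + x < y + x
    0+x<y+x = +-monoˡ-< x 0<y

  <-≤-trans : ∀ {x y z} → x < y → y ≤ z → x < z
  <-≤-trans (x≤y , x≉y) y≤z =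
    ≤-trans x≤y y≤z , λ x≈z → x≉y (≤-antisym x≤y (≤-respʳ (sym x≈z) y≤z))

  ≤-<-trans : ∀ {x y z} → x ≤ y → y < z → x < z
  ≤-<-trans x≤y (y≤z , y≉z) =
    ≤-trans x≤y y≤z , λ x≈z → y≉z (≤-antisym y≤z (≤-respˡ x≈z x≤y))

  inverse-pos : ∀ {c} → 0# < c → ∃ λ d → c * d ≈ 1# × 0# < d
  inverse-pos {c} (0≤c , 0≉c) with inverse c (0≉c ∘ sym)
  ... | d , cd≈1 = d , cd≈1 , ≮⇒≥ d≮0 , λ 0≈d → 0≉1 (trans (sym (zeroʳ c)) (trans (*-congˡ 0≈d) cd≈1))
    where
    d≮0 : ¬ d < 0#
    d≮0 (d≤0 , _) = <⇒≱ 0<1 (≤-respˡ cd≈1 (≤-respʳ (zeroʳ c) (*-monoˡ-≤ 0≤c d≤0)))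


  -- Every weight obtained by division comes from here: `half`, `third`, and the factors that
  -- rescale one weight to a larger one.
  quotient : ∀ {x y} → 0# < x → x < y → ∃ λ c → value c * y ≈ x
  quotient {x} {y} 0<x x<y with inverse-pos (<-≤-trans 0<x (proj₁ x<y))
  ... | d , yd≈1 , 0<d = record
    { value = x * d
    ; 0<    = *-pos 0<x 0<d
    ; <1    = ≤-respˡ (*-comm d x) (≤-respʳ dy≈1 (*-monoˡ-≤ (proj₁ 0<d) (proj₁ x<y)))
            , λ xd≈1 → proj₂ x<y (*-cancelˡ (proj₂ 0<d ∘ sym)
                (trans (*-comm d x) (trans xd≈1 (sym dy≈1))))
    } , trans (*-assoc x d y) (trans (*-congˡ dy≈1) (*-identityʳ x))
    where
    dy≈1 : d * y ≈ 1#
    dy≈1 = trans (*-comm d y) yd≈1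

  ≉0 : (p : OpenUnit) → value p ≉ 0#
  ≉0 p p≈0 = proj₂ (0< p) (sym p≈0)

  complement : OpenUnit → OpenUnit
  complement p = record
    { value = 1# - value p
    ; 0<    = 0≤y-x (proj₁ (<1 p)) , λ 0≈p̄ → proj₂ (<1 p)
                (trans (sym (+-identityʳ _)) (trans (+-congˡ 0≈p̄) (x+[y-x] _ _)))
    ; <1    = y-x≤y (proj₁ (0< p)) , λ p̄≈1 → proj₂ (0< p) (+-cancelʳ 1# 0# (value p)
                (trans (+-identityˡ 1#) (trans (sym (x+[y-x] _ _)) (+-congˡ p̄≈1))))
    }

  p+p̄≈1 : ∀ p → value p + value (complement p) ≈ 1#
  p+p̄≈1 p = x+[y-x] (value p) 1#

  p̄-unique : ∀ {p y} → p + y ≈ 1# → y ≈ 1# - p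
  p̄-unique {p} {y} p+y≈1 = +-cancelˡ p y (1# - p) (trans p+y≈1 (sym (x+[y-x] p 1#)))

  infixl 7 _⊗_
  _⊗_ : OpenUnit → OpenUnit → OpenUnit
  p ⊗ q = record
    { value = value p * value q
    ; 0<    = *-pos (0< p) (0< q)
    ; <1    = ≤-trans pq≤p (proj₁ (<1 p))
            , λ pq≈1 → <⇒≱ (<1 p) (≤-respˡ pq≈1 pq≤p)
    }
    where
    pq≤p : value p * value q ≤ value p
    pq≤p = *-monoʳ-≤1 (proj₁ (0< p)) (proj₁ (<1 q))

  half : ∃ λ h → value h + value h ≈ 1#
  half with quotient 0<1 (x<x+y 1# 0<1)
  ... | h , h2≈1 = h , trans (solve 1 (λ h → h :+ h := h :* (con 1 :+ con 1)) refl (value h)) h2≈1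

  third : ∃ λ t → value t + (value t + value t) ≈ 1#
  third with quotient 0<1 (x<x+y 1# (<-≤-trans 0<1 (proj₁ (x<x+y 1# 0<1))))
  ... | t , t3≈1 =
    t , trans (solve 1 (λ t → t :+ (t :+ t) := t :* (con 1 :+ (con 1 :+ con 1))) refl (value t)) t3≈1

  -- Negation turns the supremum of the values - f n into an infimum of the values f n.
  infimum : ∀ (f : ℕ → Carrier) {r} → (∀ n → r ≤ f n) →
            ∃ λ i → (∀ n → i ≤ f n) × (∀ l → (∀ n → l ≤ f n) → l ≤ i)
  infimum f {r} r≤f with supremum (λ x → ∃ λ n → x ≈ - f n) (_ , 0 , refl)
                           (- r , λ { _ (n , x≈) → ≤-respˡ (sym x≈) (neg-mono-≤ (r≤f n)) })
  ... | s , upper , least = - s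
      , (λ n → ≤-respʳ (-‿involutive _) (neg-mono-≤ (upper _ (n , refl))))
      , λ l l≤f → ≤-respˡ (-‿involutive _)
          (neg-mono-≤ (least (- l) λ { _ (n , x≈) → ≤-respˡ (sym x≈) (neg-mono-≤ (l≤f n)) }))

  -- The exponent is n + 1, which keeps every power strictly below one and hence an `OpenUnit`.
  power : OpenUnit → ℕ → OpenUnit
  power p zero    = p
  power p (suc n) = p ⊗ power p n

  -- The infimum i of the powers of p satisfies i / p ≤ i, so it is not positive.
  archimedean : ∀ p {r} → 0# < r → ∃ λ n → value (power p n) < r
  archimedean p {r} 0<r with decide (∃ λ n → value (power p n) < r)
  ... | yes found = found
  ... | no  none with infimum (value ∘ power p) (λ n → ≮⇒≥ (λ lt → none (n , lt)))
                    | inverse-pos (0< p)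
  ...   | i , i≤powers , greatest | d , pd≈1 , 0<d = contradiction i≈pi i≉pi
    where
    0<i : 0# < i
    0<i = <-≤-trans 0<r (greatest _ (λ n → ≮⇒≥ (λ lt → none (n , lt))))

    dp-cancel : ∀ x → d * (value p * x) ≈ x
    dp-cancel x = trans (sym (*-assoc d _ x)) (trans (*-congʳ (trans (*-comm d _) pd≈1)) (*-identityˡ x))

    pd-cancel : ∀ x → value p * (d * x) ≈ x
    pd-cancel x = trans (sym (*-assoc _ d x)) (trans (*-congʳ pd≈1) (*-identityˡ x))

    di≤i : d * i ≤ i
    di≤i = greatest _ (λ n → ≤-respʳ (dp-cancel _) (*-monoˡ-≤ (proj₁ 0<d) (i≤powers (suc n))))

    i≈pi : i * 1# ≈ i * value p
    i≈pi = trans (*-identityʳ i) (≤-antisym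
      (≤-respˡ (pd-cancel i) (≤-respʳ (*-comm _ i) (*-monoˡ-≤ (proj₁ (0< p)) di≤i)))
      (*-monoʳ-≤1 (proj₁ 0<i) (proj₁ (<1 p))))

    i≉pi : i * 1# ≉ i * value p
    i≉pi eq = proj₂ (<1 p) (sym (*-cancelˡ (proj₂ 0<i ∘ sym) eq))

  complement-involutive : ∀ p → value (complement (complement p)) ≈ value p
  complement-involutive p = sym (p̄-unique (trans (+-comm _ _) (p+p̄≈1 p)))

  <-complement : ∀ {x y} → x < 1# - y → y < 1# - x
  <-complement {x} {y} x<ȳ = <-≤-trans (≤-<-trans (≤-reflexive (sym (x+[y-x] x y))) (+-monoˡ-< z x<ȳ)) (≤-reflexive shift)
    where
    z = y - x
    shift : (1# - y) + z ≈ 1# - x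
    shift = p̄-unique (begin
      x + ((1# - y) + z) ≈⟨ solve 3 (λ x y z → x :+ (y :+ z) := y :+ (x :+ z)) refl x (1# - y) z ⟩
      (1# - y) + (x + z) ≈⟨ +-congˡ (x+[y-x] x y) ⟩
      (1# - y) + y       ≈⟨ y-x+x y 1# ⟩
      1#                 ∎)

  lerp : Carrier → Carrier → Carrier → Carrier
  lerp p x y = p * x + (1# - p) * y

  -- Moving twice toward x multiplies the weights left on y; the weight of x then follows, as both
  -- pairs of weights sum to one.
  lerp-fold : ∀ {p q r} x y → 1# - r ≈ (1# - p) * (1# - q) → lerp p x (lerp q x y) ≈ lerp r x y
  lerp-fold {p} {q} {r} x y r̄≈p̄q̄ = begin
    p * x + p̄ * (q * x + q̄ * y)     ≈⟨ solve 6 (λ p p̄ q q̄ x y → p :* x :+ p̄ :* (q :* x :+ q̄ :* y)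
                                         := (p :+ p̄ :* q) :* x :+ (p̄ :* q̄) :* y) refl p p̄ q q̄ x y ⟩
    (p + p̄ * q) * x + (p̄ * q̄) * y  ≈⟨ +-cong (*-congʳ p+p̄q≈r) (*-congʳ (sym r̄≈p̄q̄)) ⟩
    r * x + (1# - r) * y            ∎
    where
    p̄ = 1# - p
    q̄ = 1# - q
    p+p̄q≈r : p + p̄ * q ≈ r
    p+p̄q≈r = +-cancelʳ (1# - r) _ _ (begin
      (p + p̄ * q) + (1# - r) ≈⟨ +-congˡ r̄≈p̄q̄ ⟩
      (p + p̄ * q) + p̄ * q̄   ≈⟨ solve 4 (λ p p̄ q q̄ → (p :+ p̄ :* q) :+ p̄ :* q̄ := p :+ p̄ :* (q :+ q̄)) refl p p̄ q q̄ ⟩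
      p + p̄ * (q + q̄)        ≈⟨ +-congˡ (trans (*-congˡ (x+[y-x] q 1#)) (*-identityʳ p̄)) ⟩
      p + p̄                  ≈⟨ x+[y-x] p 1# ⟩
      1#                     ≈⟨ x+[y-x] r 1# ⟨
      r + (1# - r)           ∎)

  lerp-cancelˡ : ∀ p {x y z} → lerp (value p) x y ≈ lerp (value p) x z → y ≈ z
  lerp-cancelˡ p eq = *-cancelˡ (≉0 (complement p)) (+-cancelˡ _ _ _ eq)

  -- If y were negative, weights p with p (x - y) = - y / 2 would give a negative value.
  lerp-nonNeg⁻ : ∀ {x y} → 0# ≤ x → (∀ p → 0# ≤ lerp (value p) x y) → 0# ≤ y
  lerp-nonNeg⁻ {x} {y} 0≤x 0≤lerp = ≮⇒≥ y≮0
    where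
    y≮0 : ¬ y < 0#
    y≮0 (y≤0 , y≉0) = <⇒≱ hz<z z≤hz
      where
      z = - y
      h = value (proj₁ half)

      0<z : 0# < z
      0<z = 0≤-x y≤0 , λ 0≈z → y≉0 (trans (sym (+-identityʳ y)) (trans (+-congˡ 0≈z) (-‿inverseʳ y)))

      0<hz : 0# < h * z
      0<hz = *-pos (0< (proj₁ half)) 0<z

      hz<z : h * z < z
      hz<z = <-≤-trans (x<x+y (h * z) 0<hz) (≤-reflexive
        (trans (sym (distribʳ z h h)) (trans (*-congʳ (proj₂ half)) (*-identityˡ z))))

      u = quotient 0<hz (<-≤-trans hz<z (≤-respˡ (+-identityˡ z) (+-monoˡ-≤ z 0≤x)))
      p = value (proj₁ u)

      lerp+z≈hz : lerp p x y + z ≈ h * z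
      lerp+z≈hz = begin
        (p * x + p̄ * y) + z              ≈⟨ +-congˡ (sym (trans (*-congʳ (x+[y-x] p 1#)) (*-identityˡ z))) ⟩
        (p * x + p̄ * y) + (p + p̄) * z    ≈⟨ solve 5 (λ p p̄ x y z → (p :* x :+ p̄ :* y) :+ (p :+ p̄) :* z
                                              := p :* (x :+ z) :+ p̄ :* (y :+ z)) refl p p̄ x y z ⟩
        p * (x + z) + p̄ * (y + z)        ≈⟨ +-congˡ (trans (*-congˡ (-‿inverseʳ y)) (zeroʳ p̄)) ⟩
        p * (x + z) + 0#                 ≈⟨ +-identityʳ _ ⟩
        p * (x + z)                      ≈⟨ proj₂ u ⟩
        h * z                            ∎
        where p̄ = 1# - p

      z≤hz : z ≤ h * z
      z≤hz = ≤-respˡ (+-identityˡ z) (≤-respʳ lerp+z≈hz (+-monoˡ-≤ z (0≤lerp (proj₁ u))))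

-- Finite weights: supports, mixtures and conditioning.

module WeightsProperties {a} (em : ExcludedMiddle a) (ℝ : CompleteOrderedField) where
  open CompleteOrderedField ℝ
  open Convexity ℝ
  open OrderedFieldProperties em ℝ
  open Algebra.Properties.Ring ring using (+-cancelʳ)
  open Algebra.Properties.CommutativeMonoid.Sum +-commutativeMonoid using (∑-distrib-+)

  weights : ∀ {n} (f : Fin (suc n) → Carrier) → (∀ i → 0# ≤ f i) → sum f ≈ 1# → Weights n
  weights f 0≤f total≈1 = record
    { weight = f
    ; 0≤     = 0≤f
    ; ≤1     = λ i → ≤-respʳ total≈1 (term≤sum 0≤f i)
    ; total  = total≈1
    }

  pointMass : ∀ {n} → Fin (suc n) → Weights n
  pointMass i = weights f 0≤f (trans (sum-single i f≈0) fi≈1)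
    where
    f : _ → Carrier
    f j = if does (i Fin.≟ j) then 1# else 0#

    0≤f : ∀ j → 0# ≤ f j
    0≤f j with i Fin.≟ j
    ... | yes _ = proj₁ 0<1
    ... | no  _ = ≤-refl

    f≈0 : ∀ j → j ≢ i → f j ≈ 0#
    f≈0 j j≢i with i Fin.≟ j
    ... | yes i≡j = contradiction (≡-sym i≡j) j≢i
    ... | no  _   = refl

    fi≈1 : f i ≈ 1#
    fi≈1 with i Fin.≟ i
    ... | yes _   = refl
    ... | no  i≢i = contradiction ≡-refl i≢i

  pointMass-self : ∀ {n} (i : Fin (suc n)) → weight (pointMass i) i ≈ 1#
  pointMass-self i with i Fin.≟ i
  ... | yes _   = refl
  ... | no  i≢i = contradiction ≡-refl i≢i

  sum-≉0 : ∀ {n} {f : Fin n → Carrier} → sum f ≉ 0# → ∃ λ i → f i ≉ 0#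
  sum-≉0 {n} sum≉0 = Fin.¬∀⟶∃¬ n _ (λ i → _ ≈? _) (sum≉0 ∘ sum-zero)

  ∃-support : ∀ {n} (p : Weights n) → ∃ λ i → weight p i ≉ 0#
  ∃-support p = sum-≉0 (λ sum≈0 → 0≉1 (trans (sym sum≈0) (total p)))

  -- All summands are nonnegative, so nothing cancels and one nonzero summand makes the sum nonzero.
  mix-support⁺ : ∀ {n m} (p : Weights n) (q : Fin (suc n) → Weights m) i {j} →
                 weight p i ≉ 0# → weight (q i) j ≉ 0# → weight (mix p q) j ≉ 0#
  mix-support⁺ p q i {j} pi≉0 qij≉0 sum≈0 = *≉0 pi≉0 qij≉0
    (≤-antisym (≤-respʳ sum≈0 (term≤sum nonNegative i)) (nonNegative i))
    where
    nonNegative : ∀ i → 0# ≤ weight p i * weight (q i) j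
    nonNegative i = *-nonNeg (0≤ p i) (0≤ (q i) j)

  mix-support⁻ : ∀ {n m} (p : Weights n) (q : Fin (suc n) → Weights m) {j} →
                 weight (mix p q) j ≉ 0# → ∃ λ i → weight p i ≉ 0# × weight (q i) j ≉ 0#
  mix-support⁻ p q r≉0 with sum-≉0 r≉0
  ... | i , pq≉0 = i , (λ p≈0 → pq≉0 (trans (*-congʳ p≈0) (zeroˡ _)))
                     , (λ q≈0 → pq≉0 (trans (*-congˡ q≈0) (zeroʳ _)))

  -- Both families have total one, so the entry at `zero` is determined by the remaining ones.
  weights-ext : ∀ {n} (p q : Weights n) → (∀ i → weight p (suc i) ≈ weight q (suc i)) →
                ∀ i → weight p i ≈ weight q i
  weights-ext p q p≈q (suc i) = p≈q i
  weights-ext p q p≈q zero    = +-cancelʳ (sum (weight q ∘ suc)) _ _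
    (trans (+-congˡ (sym (sum-cong-≋ p≈q))) (trans (total p) (sym (total q))))

  restrict : ∀ {n} → (Fin n → Bool) → (Fin n → Carrier) → Fin n → Carrier
  restrict D f i = if D i then f i else 0#

  restrict-nonNeg : ∀ {n} (D : Fin n → Bool) {f} → (∀ i → 0# ≤ f i) → ∀ i → 0# ≤ restrict D f i
  restrict-nonNeg D 0≤f i with D i
  ... | true  = 0≤f i
  ... | false = ≤-refl

  restrict-split : ∀ {n} (D : Fin n → Bool) f i → restrict D f i + restrict (not ∘ D) f i ≈ f i
  restrict-split D f i with D i
  ... | true  = +-identityʳ _
  ... | false = +-identityˡ _

  -- Conditional probability given the event D: the weights outside D are set to zero and the others
  -- divided by c, the probability of D.
  conditional : ∀ {n} (p : Weights n) (D : Fin (suc n) → Bool) (c : OpenUnit) →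
                sum (restrict D (weight p)) ≈ value c → Weights n
  conditional p D c sum≈c = let (d , cd≈1 , 0<d) = inverse-pos (0< c) in weights
    (λ i → d * restrict D (weight p) i)
    (λ i → *-nonNeg (proj₁ 0<d) (restrict-nonNeg D (0≤ p) i))
    (trans (sym (*-distribˡ-sum d (restrict D (weight p)))) (trans (*-congˡ sum≈c) (trans (*-comm d _) cd≈1)))

  conditional-weight : ∀ {n} (p : Weights n) D c (sum≈c : sum (restrict D (weight p)) ≈ value c) i →
                       value c * weight (conditional p D c sum≈c) i ≈ restrict D (weight p) i
  conditional-weight p D c sum≈c i = let (d , cd≈1 , _) = inverse-pos (0< c) in
    trans (sym (*-assoc _ d _)) (trans (*-congʳ cd≈1) (*-identityˡ _))

  sum-complement : ∀ {n} (p : Weights n) D {c} → sum (restrict D (weight p)) ≈ c →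
                   sum (restrict (not ∘ D) (weight p)) ≈ 1# - c
  sum-complement p D sum≈c = p̄-unique (trans (+-congʳ (sym sum≈c))
    (trans (sym (∑-distrib-+ (restrict D (weight p)) (restrict (not ∘ D) (weight p))))
      (trans (sum-cong-≋ (restrict-split D (weight p))) (total p))))

  conditional-support : ∀ {n} (p : Weights n) D c sum≈c {i} →
                        weight (conditional p D c sum≈c) i ≉ 0# → D i ≡ true
  conditional-support p D c sum≈c {i} q≉0 = go (D i) ≡-refl
    where
    go : ∀ b → D i ≡ b → D i ≡ true
    go true  Di≡true  = Di≡true
    go false Di≡false = contradiction
      (*-cancelˡ (≉0 c) (trans (conditional-weight p D c sum≈c i)
        (trans (reflexive (≡-cong (if_then weight p i else 0#) Di≡false)) (sym (zeroʳ _))))) q≉0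

  sum-restrict≈0 : ∀ {n} (p : Weights n) D → sum (restrict D (weight p)) ≈ 0# →
                   ∀ {i} → weight p i ≉ 0# → D i ≡ false
  sum-restrict≈0 p D sum≈0 {i} pi≉0 with D i | term≤sum (restrict-nonNeg D (0≤ p)) i
  ... | false | _      = ≡-refl
  ... | true  | pi≤sum = contradiction (≤-antisym (≤-respʳ sum≈0 pi≤sum) (0≤ p i)) pi≉0

-- Identities valid in every convex algebra.

module ConvexAlgebraProperties
  {a} (em : ExcludedMiddle a) (ℝ : CompleteOrderedField)
  {x ℓ} {X : Set x} {_≃_ : Rel X ℓ} {combine : Convexity.Combination ℝ X}
  (isConvexAlgebra : Convexity.IsConvexAlgebra ℝ _≃_ combine)
  where
  open CompleteOrderedField ℝ
  open Convexity ℝ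
  open OrderedFieldProperties em ℝ
  open WeightsProperties em ℝ
  open IsConvexAlgebra isConvexAlgebra using (cong; projection; barycenter)
  open Algebra.Solver.Ring.NaturalCoefficients.Default commutativeSemiring
    using (solve; _:=_; _:+_; _:*_; con)
  private
    module ≃ = IsEquivalence (IsConvexAlgebra.isEquivalence isConvexAlgebra)

  binary-cong : ∀ {p q x x′ y y′} → value p ≈ value q → x ≃ x′ → y ≃ y′ →
                binary combine p x y ≃ binary combine q x′ y′
  binary-cong p≈q x≃x′ y≃y′ = cong
    (λ { zero → p≈q ; (suc zero) → +-congˡ (-‿cong p≈q) })
    (λ { zero → x≃x′ ; (suc zero) → y≃y′ })

  -- Each y is itself a combination of a single point, so the barycenter law collapses everything to
  -- one point, whose weight can only be one.
  combine-const : ∀ {n} (p : Weights n) {y} → combine p (const y) ≃ y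
  combine-const p {y} = ≃.trans (cong (λ _ → refl) (λ _ → ≃.sym (projection unit (const y) zero refl)))
    (≃.trans (barycenter p (const unit) (const y))
      (projection (mix p (const unit)) (const y) zero
        (trans (sym (+-identityʳ _)) (total (mix p (const unit))))))
    where
    unit : Weights 0
    unit = pointMass zero

  binary-idem : ∀ p {y} → binary combine p y y ≃ y
  binary-idem p {y} = ≃.trans
    (cong {p = pair p} {pair p} {y ∷ y ∷ []} {const y} (λ _ → refl)
      (λ { zero → ≃.refl ; (suc zero) → ≃.refl }))
    (combine-const (pair p) {y})

  -- By the barycenter law, reindexing the arguments amounts to mixing point masses, and moving an
  -- index of weight zero leaves that mixture unchanged.
  combine-support : ∀ {n} (p : Weights n) {x y : Fin (suc n) → X} →
                    (∀ i → weight p i ≉ 0# → x i ≃ y i) → combine p x ≃ combine p y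
  combine-support {n} p {x} {y} x≃y = ≃.trans (≃.sym (redirect-invariant x))
    (≃.trans (cong (λ _ → refl) agree) (redirect-invariant y))
    where
    k = proj₁ (∃-support p)

    -- Arguments of weight zero are replaced by one of nonzero weight.
    redirect : Fin (suc n) → Fin (suc n)
    redirect i with weight p i ≈? 0#
    ... | yes _ = k
    ... | no  _ = i

    agree : ∀ i → x (redirect i) ≃ y (redirect i)
    agree i with weight p i ≈? 0#
    ... | yes _   = x≃y k (proj₂ (∃-support p))
    ... | no pi≉0 = x≃y i pi≉0

    term : ∀ i j → weight p i * weight (pointMass (redirect i)) j ≈
                   weight p i * weight (pointMass i) j
    term i j with weight p i ≈? 0#
    ... | yes pi≈0 = trans (*-congʳ pi≈0) (trans (zeroˡ _) (sym (trans (*-congʳ pi≈0) (zeroˡ _))))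
    ... | no  _    = refl

    redirect-invariant : ∀ z → combine p (z ∘ redirect) ≃ combine p z
    redirect-invariant z = ≃.trans (expand redirect)
      (≃.trans (cong (λ j → sum-cong-≋ (λ i → term i j)) (λ _ → ≃.refl)) (≃.sym (expand id)))
      where
      expand : ∀ ρ → combine p (z ∘ ρ) ≃ combine (mix p (pointMass ∘ ρ)) z
      expand ρ = ≃.trans
        (cong (λ _ → refl) (λ i → ≃.sym (projection (pointMass (ρ i)) z (ρ i) (pointMass-self (ρ i)))))
        (barycenter p (pointMass ∘ ρ) z)

  -- Conditioning on D and on its complement and mixing with weights c and 1 - c gives p back, so
  -- this is an instance of the barycenter law.
  combine-split : ∀ {n} (p : Weights n) D c sum≈c (x : Fin (suc n) → X) →
    combine p x ≃
    binary combine c (combine (conditional p D c sum≈c) x)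
                     (combine (conditional p (not ∘ D) (complement c) (sum-complement p D sum≈c)) x)
  combine-split p D c sum≈c x = ≃.sym
    (≃.trans (cong (λ _ → refl) (λ { zero → ≃.refl ; (suc zero) → ≃.refl }))
    (≃.trans (barycenter (pair c) q x)
      (cong (λ i → trans (+-cong (conditional-weight p D c sum≈c i)
                     (trans (+-identityʳ _)
                       (conditional-weight p (not ∘ D) (complement c) (sum-complement p D sum≈c) i)))
              (restrict-split D (weight p) i)) (λ _ → ≃.refl))))
    where
    q : Fin 2 → Weights _
    q = conditional p D c sum≈c ∷
        conditional p (not ∘ D) (complement c) (sum-complement p D sum≈c) ∷ []

  -- Syntax for nested binary combinations. Identities between them reduce to comparing
  -- coefficients, which the ring solver handles.
  data Term (n : ℕ) : Set where
    var : Fin (suc n) → Term n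
    bin : OpenUnit → Term n → Term n → Term n

  evaluate : ∀ {n} → Term n → (Fin (suc n) → X) → X
  evaluate (var i)     x = x i
  evaluate (bin p s t) x = binary combine p (evaluate s x) (evaluate t x)

  coefficients : ∀ {n} → Term n → Weights n
  coefficients (var i)     = pointMass i
  coefficients (bin p s t) = mix (pair p) (coefficients s ∷ coefficients t ∷ [])

  evaluate-combine : ∀ {n} (t : Term n) x → evaluate t x ≃ combine (coefficients t) x
  evaluate-combine (var i)     x = ≃.sym (projection (pointMass i) x i (pointMass-self i))
  evaluate-combine (bin p s t) x = ≃.trans
    (cong {p = pair p} {y = λ i → combine (q i) x} (λ _ → refl)
      (λ { zero → evaluate-combine s x ; (suc zero) → evaluate-combine t x }))
    (barycenter (pair p) q x)
    where
    q = coefficients s ∷ coefficients t ∷ []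

  -- Agrees with the weights of `coefficients`, but without the trailing zero that `sum` leaves
  -- behind.
  coefficient : ∀ {n} → Term n → Fin (suc n) → Carrier
  coefficient (var i)     j = weight (pointMass i) j
  coefficient (bin p s t) j = value p * coefficient s j + (1# - value p) * coefficient t j

  coefficients-weight : ∀ {n} (t : Term n) j → weight (coefficients t) j ≈ coefficient t j
  coefficients-weight (var i)     j = refl
  coefficients-weight (bin p s t) j =
    +-cong (*-congˡ (coefficients-weight s j)) (trans (+-identityʳ _) (*-congˡ (coefficients-weight t j)))

  -- The coefficient of the variable `zero` is determined by the others.
  evaluate-unique : ∀ {n} (s t : Term n) x →
    (∀ i → coefficient s (suc i) ≈ coefficient t (suc i)) →
    evaluate s x ≃ evaluate t x
  evaluate-unique s t x s≈t = ≃.trans (evaluate-combine s x)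
    (≃.trans (cong (weights-ext (coefficients s) (coefficients t)
                     (λ i → trans (coefficients-weight s (suc i))
                       (trans (s≈t i) (sym (coefficients-weight t (suc i)))))) (λ _ → ≃.refl))
      (≃.sym (evaluate-combine t x)))

  -- The two hypotheses equate the coefficients of x and of y. Placing z at the index `zero` spares
  -- the comparison of its coefficients.
  binary-assoc : ∀ p q r s {x y z} → value r ≈ value p * value q →
    (1# - value r) * value s ≈ value p * (1# - value q) →
    binary combine p (binary combine q x y) z ≃ binary combine r x (binary combine s y z)
  binary-assoc p q r s {x} {y} {z} r≈pq r̄s≈pq̄ = evaluate-unique
    (bin p (bin q (var 1F) (var 2F)) (var 0F)) (bin r (var 1F) (bin s (var 2F) (var 0F)))
    (z ∷ x ∷ y ∷ [])
    λ { zero → trans (solve 4 (λ p p̄ q q̄ → p :* (q :* con 1 :+ q̄ :* con 0) :+ p̄ :* con 0 := p :* q)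
                       refl (value p) (1# - value p) (value q) (1# - value q))
          (trans (sym r≈pq)
            (solve 4 (λ r r̄ s s̄ → r := r :* con 1 :+ r̄ :* (s :* con 0 :+ s̄ :* con 0))
              refl (value r) (1# - value r) (value s) (1# - value s)))
      ; (suc zero) →
          trans (solve 4 (λ p p̄ q q̄ → p :* (q :* con 0 :+ q̄ :* con 1) :+ p̄ :* con 0 := p :* q̄)
                  refl (value p) (1# - value p) (value q) (1# - value q))
          (trans (sym r̄s≈pq̄)
            (solve 4 (λ r r̄ s s̄ → r̄ :* s := r :* con 0 :+ r̄ :* (s :* con 1 :+ s̄ :* con 0))
              refl (value r) (1# - value r) (value s) (1# - value s))) }

  -- Here x sits at the index `zero`, so the hypothesis on complements is the equation for the
  -- coefficient of y.
  binary-foldʳ : ∀ p q r {x y} → 1# - value r ≈ (1# - value p) * (1# - value q) →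
    binary combine p x (binary combine q x y) ≃ binary combine r x y
  binary-foldʳ p q r {x} {y} r̄≈p̄q̄ = evaluate-unique
    (bin p (var 0F) (bin q (var 0F) (var 1F))) (bin r (var 0F) (var 1F)) (x ∷ y ∷ [])
    λ { zero →
          trans (solve 4 (λ p p̄ q q̄ → p :* con 0 :+ p̄ :* (q :* con 0 :+ q̄ :* con 1) := p̄ :* q̄)
                  refl (value p) (1# - value p) (value q) (1# - value q))
          (trans (sym r̄≈p̄q̄)
            (solve 2 (λ r r̄ → r̄ := r :* con 0 :+ r̄ :* con 1) refl (value r) (1# - value r))) }

  binary-foldˡ : ∀ p q r {x y} → value r ≈ value p * value q →
    binary combine p (binary combine q x y) y ≃ binary combine r x y
  binary-foldˡ p q r {x} {y} r≈pq = evaluate-unique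
    (bin p (bin q (var 1F) (var 0F)) (var 0F)) (bin r (var 1F) (var 0F)) (y ∷ x ∷ [])
    λ { zero →
          trans (solve 4 (λ p p̄ q q̄ → p :* (q :* con 1 :+ q̄ :* con 0) :+ p̄ :* con 0 := p :* q)
                  refl (value p) (1# - value p) (value q) (1# - value q))
          (trans (sym r≈pq)
            (solve 2 (λ r r̄ → r := r :* con 1 :+ r̄ :* con 0) refl (value r) (1# - value r))) }

  -- The hypothesis says that the two exchanged points carry the same coefficient.
  binary-swap : ∀ p q {x y z} → value p ≈ (1# - value p) * value q →
    binary combine p x (binary combine q y z) ≃ binary combine p y (binary combine q x z)
  binary-swap p q {x} {y} {z} p≈p̄q = evaluate-unique
    (bin p (var 1F) (bin q (var 2F) (var 0F))) (bin p (var 2F) (bin q (var 1F) (var 0F)))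
    (z ∷ x ∷ y ∷ [])
    λ { zero → trans front (trans p≈p̄q (sym back))
      ; (suc zero) → trans back (trans (sym p≈p̄q) (sym front)) }
    where
    front : value p * 1# + (1# - value p) * (value q * 0# + (1# - value q) * 0#) ≈ value p
    front = solve 4 (λ p p̄ q q̄ → p :* con 1 :+ p̄ :* (q :* con 0 :+ q̄ :* con 0) := p)
              refl (value p) (1# - value p) (value q) (1# - value q)

    back : value p * 0# + (1# - value p) * (value q * 1# + (1# - value q) * 0#) ≈ (1# - value p) * value q
    back = solve 4 (λ p p̄ q q̄ → p :* con 0 :+ p̄ :* (q :* con 1 :+ q̄ :* con 0) := p̄ :* q)
              refl (value p) (1# - value p) (value q) (1# - value q)

-- Distributions: point masses and extremal points.

module FreeConvexAlgebraProperties
  {a} (em : ExcludedMiddle a) (ℝ : CompleteOrderedField) (S : Set a) where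
  open CompleteOrderedField ℝ
  open Convexity ℝ
  open FreeConvexAlgebra em ℝ S
  open OrderedFieldProperties em ℝ
  open WeightsProperties em ℝ
  open ConvexAlgebraProperties em ℝ (ConvexAlgebra.isConvexAlgebra 𝔻) public
    using (combine-const; combine-support; combine-split; binary-idem; binary-swap)
  open IsConvexAlgebra (ConvexAlgebra.isConvexAlgebra 𝔻) public
    using (projection; barycenter) renaming (isEquivalence to ≐-isEquivalence; cong to combine-cong)
  module ≐ = IsEquivalence ≐-isEquivalence

  binary-mass : ∀ p ξ η s → mass (binary combineD p ξ η) s ≈
                            value p * mass ξ s + (1# - value p) * mass η s
  binary-mass p ξ η s = +-congˡ (+-identityʳ _)

  binary-comm : ∀ p ξ η → binary combineD p ξ η ≐ binary combineD (complement p) η ξ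
  binary-comm p ξ η s = trans (binary-mass p ξ η s)
    (trans (+-comm _ _)
      (trans (+-congˡ (*-congʳ (p̄-unique (trans (+-comm _ _) (p+p̄≈1 p)))))
        (sym (binary-mass (complement p) η ξ s))))

  dirac : S → Distribution
  dirac s = record
    { mass    = δ
    ; nonNeg  = 0≤δ
    ; cover   = s List.∷ List.[]
    ; unique  = ListAll.[] AllPairs.∷ AllPairs.[]
    ; outside = λ t∉ → dirac-other (λ s≡t → t∉ (here (≡-sym s≡t)))
    ; total-1 = trans (+-identityʳ _) dirac-self
    }
    where
    δ : S → Carrier
    δ t = if does (em {s ≡ t}) then 1# else 0#

    0≤δ : ∀ t → 0# ≤ δ t
    0≤δ t with em {s ≡ t}
    ... | yes _ = proj₁ 0<1
    ... | no  _ = ≤-refl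

    dirac-self : δ s ≈ 1#
    dirac-self with em {s ≡ s}
    ... | yes _  = refl
    ... | no s≢s = contradiction ≡-refl s≢s

    dirac-other : ∀ {t} → s ≢ t → δ t ≈ 0#
    dirac-other {t} s≢t with em {s ≡ t}
    ... | yes s≡t = contradiction s≡t s≢t
    ... | no  _   = refl

  dirac-injective : ∀ {s t} → dirac s ≐ dirac t → s ≡ t
  dirac-injective {s} {t} δs≐δt with em {s ≡ t} | em {t ≡ t} | δs≐δt t
  ... | yes s≡t | _       | _   = s≡t
  ... | no _    | yes _   | 0≈1 = contradiction 0≈1 0≉1
  ... | no _    | no t≢t  | _   = contradiction ≡-refl t≢t

  -- Extremality concerns binary combinations only. If the weight at i is not one, splitting p at
  -- the single index i exhibits w as a proper binary combination whose first point is x i;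
  -- otherwise projection applies.
  extremal-support : ∀ {w} → Extremal 𝔻 w → ∀ {n} (p : Weights n) x →
                     combineD p x ≐ w → ∀ {i} → weight p i ≉ 0# → x i ≐ w
  extremal-support {w} extremal p x px≐w {i} pi≉0 with weight p i ≈? 1#
  ... | yes pi≈1 = λ s → trans (sym (projection p x i pi≈1 s)) (px≐w s)
  ... | no  pi≉1 = λ s → trans (sym (projection q x i qi≈1 s))
                     (proj₁ (extremal c (combineD q x) (combineD q′ x)
                       (λ s → trans (sym (combine-split p D c sum≈c x s)) (px≐w s))) s)
    where
    c : OpenUnit
    c = record { value = weight p i ; 0< = 0≤ p i , pi≉0 ∘ sym ; <1 = ≤1 p i , pi≉1 }

    D : Fin _ → Bool
    D j = does (i Fin.≟ j)

    restricted-other : ∀ j → j ≢ i → restrict D (weight p) j ≈ 0#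
    restricted-other j j≢i with i Fin.≟ j
    ... | yes i≡j = contradiction (≡-sym i≡j) j≢i
    ... | no  _   = refl

    restricted-self : restrict D (weight p) i ≈ weight p i
    restricted-self with i Fin.≟ i
    ... | yes _  = refl
    ... | no i≢i = contradiction ≡-refl i≢i

    sum≈c : sum (restrict D (weight p)) ≈ weight p i
    sum≈c = trans (sum-single i restricted-other) restricted-self

    q q′ : Weights _
    q  = conditional p D c sum≈c
    q′ = conditional p (not ∘ D) (complement c) (sum-complement p D sum≈c)

    qi≈1 : weight q i ≈ 1#
    qi≈1 = *-cancelˡ pi≉0 (trans (conditional-weight p D c sum≈c i)
             (trans restricted-self (sym (*-identityʳ _))))

  -- Construction of an extension with a prescribed set of adherence.

  record AdherenceSet (w : Distribution) : Set (ℓsuc a) where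
    field
      Adheres  : Distribution → Set a
      respects : ∀ {ξ η} → ξ ≐ η → Adheres ξ → Adheres η
      convex   : ∀ {n} (p : Weights n) x → (∀ i → weight p i ≉ 0# → Adheres (x i)) →
                 Adheres (combineD p x)
      face     : ∀ {n} (p : Weights n) x → Adheres (combineD p x) →
                 ∀ i → weight p i ≉ 0# → Adheres (x i)
      extent   : (∀ ξ → Adheres ξ) ⊎ (∀ {ξ} → Adheres ξ → ξ ≐ w)

  module Extend {w : Distribution} (adherenceSet : AdherenceSet w) where
    open AdherenceSet adherenceSet

    fill : Maybe Distribution → Distribution
    fill = fromMaybe w

    -- Only indices of nonzero weight count, and `All Adheres` holds at `⋆` by definition.
    Absorbs : ∀ {n} → Weights n → (Fin (suc n) → Maybe Distribution) → Set a
    Absorbs p x = (∃ λ i → weight p i ≉ 0# × x i ≡ ⋆) ×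
                  (∀ i → weight p i ≉ 0# → All Adheres (x i))

    combineₑ : Combination (Maybe Distribution)
    combineₑ p x = if does (em {Absorbs p x}) then ⋆ else just (combineD p (fill ∘ x))

    -- The graph of `combineₑ`: matching on it yields the value together with the reason for it,
    -- without unfolding the decision by `em`.
    data Value {n} (p : Weights n) x : Maybe Distribution → Set a where
      absorbed : Absorbs p x → Value p x ⋆
      regular  : ¬ Absorbs p x → Value p x (just (combineD p (fill ∘ x)))

    evaluated : ∀ {n} (p : Weights n) x → Value p x (combineₑ p x)
    evaluated p x with em {Absorbs p x}
    ... | yes absorbs = absorbed absorbs
    ... | no ¬absorbs = regular ¬absorbs

    combine-absorbed : ∀ {n} (p : Weights n) x → Absorbs p x → combineₑ p x ≡ ⋆
    combine-absorbed p x absorbs with em {Absorbs p x}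
    ... | yes _       = ≡-refl
    ... | no ¬absorbs = contradiction absorbs ¬absorbs

    absorbed-⋆ : ∀ {n} {p : Weights n} {x v} → Value p x v → v ≡ ⋆ → Absorbs p x
    absorbed-⋆ (absorbed absorbs) _ = absorbs

    combine-regular : ∀ {n} (p : Weights n) x → ¬ Absorbs p x →
                      combineₑ p x ≡ just (combineD p (fill ∘ x))
    combine-regular p x ¬absorbs with em {Absorbs p x}
    ... | yes absorbs = contradiction absorbs ¬absorbs
    ... | no _        = ≡-refl

    infix 4 _≃_
    _≃_ : Rel (Maybe Distribution) a
    _≃_ = Pointwise _≐_

    fill-cong : ∀ {x y} → x ≃ y → fill x ≐ fill y
    fill-cong (just ξ≐η) = ξ≐η
    fill-cong nothing    = ≐.refl {w}

    adheres-fill⁻ : ∀ v → Adheres (fill v) → All Adheres v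
    adheres-fill⁻ (just _) adheres = just adheres
    adheres-fill⁻ nothing  _       = nothing

    adheres-fill⁺ : ∀ {v} → v ≢ ⋆ → All Adheres v → Adheres (fill v)
    adheres-fill⁺ _   (just adheres) = adheres
    adheres-fill⁺ v≢⋆ nothing        = contradiction ≡-refl v≢⋆

    absorbs-cong : ∀ {n} {p q : Weights n} {x y} → (∀ i → weight p i ≈ weight q i) →
                   (∀ i → x i ≃ y i) → Absorbs p x → Absorbs q y
    absorbs-cong p≈q x≃y ((i , pi≉0 , xi≡⋆) , adheres) =
      (i , pi≉0 ∘ trans (p≈q i) , star (x≃y i) xi≡⋆) ,
      λ j qj≉0 → transport (x≃y j) (adheres j (qj≉0 ∘ trans (sym (p≈q j))))
      where
      star : ∀ {u v} → u ≃ v → u ≡ ⋆ → v ≡ ⋆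
      star nothing _ = ≡-refl

      transport : ∀ {u v} → u ≃ v → All Adheres u → All Adheres v
      transport (just ξ≐η) (just adheres) = just (respects ξ≐η adheres)
      transport nothing    nothing        = nothing

    ≃-sym : ∀ {u v} → u ≃ v → v ≃ u
    ≃-sym = Pointwise.sym (λ {ξ} {η} → ≐.sym {ξ} {η})

    cong : ∀ {n} {p q : Weights n} {x y} → (∀ i → weight p i ≈ weight q i) →
           (∀ i → x i ≃ y i) → combineₑ p x ≃ combineₑ q y
    cong {p = p} {q} {x} {y} p≈q x≃y
      with combineₑ p x | evaluated p x | combineₑ q y | evaluated q y
    ... | _ | absorbed _    | _ | absorbed _    = nothing
    ... | _ | regular _     | _ | regular _     =
      just (combine-cong {p = p} {q} {fill ∘ x} {fill ∘ y} p≈q (fill-cong ∘ x≃y))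
    ... | _ | absorbed abs  | _ | regular ¬abs  = contradiction (absorbs-cong {p = p} {q} p≈q x≃y abs) ¬abs
    ... | _ | regular ¬abs  | _ | absorbed abs  =
      contradiction (absorbs-cong {p = q} {p} (sym ∘ p≈q) (≃-sym ∘ x≃y) abs) ¬abs

    -- The support is the single index j, so the combination is absorbed exactly when x j is `⋆`.
    project : ∀ {n} (p : Weights n) x j → weight p j ≈ 1# → combineₑ p x ≃ x j
    project p x j pj≈1 = go (x j) ≡-refl (evaluated p x)
      where
      pj≉0 : weight p j ≉ 0#
      pj≉0 pj≈0 = 0≉1 (trans (sym pj≈0) pj≈1)

      only : ∀ {i} → weight p i ≉ 0# → i ≡ j
      only {i} pi≉0 with i Fin.≟ j
      ... | yes i≡j = i≡j
      ... | no  i≢j = contradiction (weight≈0 p pj≈1 i≢j) pi≉0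

      go : ∀ v → x j ≡ v → ∀ {u} → Value p x u → u ≃ v
      go nothing  xj≡⋆  (absorbed _)   = nothing
      go (just ξ) xj≡ξ  (absorbed ((i , pi≉0 , xi≡⋆) , _)) with only pi≉0
      ... | ≡-refl with ≡-trans (≡-sym xj≡ξ) xi≡⋆
      ...   | ()
      go nothing  xj≡⋆  (regular ¬abs) = contradiction
        ((j , pj≉0 , xj≡⋆) , λ i pi≉0 → ≡-subst (All Adheres ∘ x) (≡-sym (only pi≉0))
                                          (≡-subst (All Adheres) (≡-sym xj≡⋆) nothing)) ¬abs
      go (just ξ) xj≡ξ  (regular _)    = just
        (≡-subst (λ v → combineD p (fill ∘ x) ≐ fill v) xj≡ξ (projection p (fill ∘ x) j pj≈1))

    -- In the absorbed case the left side is w. The side condition then turns every filled argument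
    -- of nonzero weight into w, so the right side is w as well.
    fill-combine : ∀ {n} (p : Weights n) x → (Absorbs p x → ∀ {ξ} → Adheres ξ → ξ ≐ w) →
                   fill (combineₑ p x) ≐ combineD p (fill ∘ x)
    fill-combine p x w-only with combineₑ p x | evaluated p x
    ... | _ | regular _                  = ≐.refl {combineD p (fill ∘ x)}
    ... | _ | absorbed abs@(_ , adheres) = λ s → sym
      (trans (combine-support p {fill ∘ x} {const w} (λ i pi≉0 → fill≐w (adheres i pi≉0)) s)
             (combine-const p {w} s))
      where
      fill≐w : ∀ {v} → All Adheres v → fill v ≐ w
      fill≐w (just a) = w-only abs a
      fill≐w nothing  = ≐.refl {w}

    module _ {n m : ℕ} (p : Weights n) (q : Fin (suc n) → Weights m) (x : Fin (suc m) → Maybe Distribution) where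
      y : Fin (suc n) → Maybe Distribution
      y i = combineₑ (q i) x

      -- An inner combination that adheres as a distribution passes adherence to its arguments by
      -- the face property.
      absorbs-mix : Absorbs p y → Absorbs (mix p q) x
      absorbs-mix ((i , pi≉0 , yi≡⋆) , adheres) = star (absorbed-⋆ (evaluated (q i) x) yi≡⋆) , adheres′
        where
        star : Absorbs (q i) x → ∃ λ j → weight (mix p q) j ≉ 0# × x j ≡ ⋆
        star ((j , qij≉0 , xj≡⋆) , _) = j , mix-support⁺ p q i pi≉0 qij≉0 , xj≡⋆

        inner : ∀ {i v} → Value (q i) x v → All Adheres v → ∀ j → weight (q i) j ≉ 0# → All Adheres (x j)
        inner     (absorbed (_ , adh)) _            j qij≉0 = adh j qij≉0
        inner {i} (regular _)          (just adh)   j qij≉0 =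
          adheres-fill⁻ (x j) (face (q i) (fill ∘ x) adh j qij≉0)

        adheres′ : ∀ j → weight (mix p q) j ≉ 0# → All Adheres (x j)
        adheres′ j rj≉0 with mix-support⁻ p q rj≉0
        ... | k , pk≉0 , qkj≉0 = inner (evaluated (q k) x) (adheres k pk≉0) j qkj≉0

      -- An inner combination containing `⋆` in its support is itself absorbed; one without `⋆`
      -- adheres by convexity.
      absorbs-unmix : Absorbs (mix p q) x → Absorbs p y
      absorbs-unmix ((j , rj≉0 , xj≡⋆) , adheres) with mix-support⁻ p q rj≉0
      ... | i , pi≉0 , qij≉0 =
        (i , pi≉0 , combine-absorbed (q i) x
          ((j , qij≉0 , xj≡⋆) , λ k qik≉0 → adheres k (mix-support⁺ p q i pi≉0 qik≉0))) ,
        λ k pk≉0 → outer k pk≉0 (evaluated (q k) x)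
        where
        outer : ∀ k → weight p k ≉ 0# → ∀ {v} → Value (q k) x v → All Adheres v
        outer k pk≉0 (absorbed _)   = nothing
        outer k pk≉0 (regular ¬abs) = just (convex (q k) (fill ∘ x) (λ j qkj≉0 →
          adheres-fill⁺ (λ xj≡⋆ → ¬abs ((j , qkj≉0 , xj≡⋆) ,
                            λ l qkl≉0 → adheres l (mix-support⁺ p q k pk≉0 qkl≉0)))
                        (adheres j (mix-support⁺ p q k pk≉0 qkj≉0))))

      -- Trouble could come only from absorbed inner combinations, which are refilled with w. If all
      -- distributions adhere, one of them would make the outer combination absorbed too; if only w
      -- can adhere, refilling with w is correct by `fill-combine`.
      regular-mix : ¬ Absorbs p y → combineD p (fill ∘ y) ≐ combineD (mix p q) (fill ∘ x)
      regular-mix ¬abs s = trans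
        (combine-support p {fill ∘ y} {λ i → combineD (q i) (fill ∘ x)}
          (λ i pi≉0 → fill-combine (q i) x (w-only i pi≉0)) s)
        (barycenter p q (fill ∘ x) s)
        where
        all : (∀ ξ → Adheres ξ) → ∀ v → All Adheres v
        all adheres (just ξ) = just (adheres ξ)
        all adheres nothing  = nothing

        w-only : ∀ i → weight p i ≉ 0# → Absorbs (q i) x → ∀ {ξ} → Adheres ξ → ξ ≐ w
        w-only i pi≉0 abs {ξ} with extent
        ... | inj₁ adheres = contradiction
          ((i , pi≉0 , combine-absorbed (q i) x abs) , λ j _ → all adheres (y j)) ¬abs
        ... | inj₂ ⊆w      = ⊆w {ξ}

      bary : combineₑ p y ≃ combineₑ (mix p q) x
      bary with combineₑ p y | evaluated p y | combineₑ (mix p q) x | evaluated (mix p q) x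
      ... | _ | absorbed _    | _ | absorbed _    = nothing
      ... | _ | regular ¬abs  | _ | regular _     = just (regular-mix ¬abs)
      ... | _ | absorbed abs  | _ | regular ¬abs  = contradiction (absorbs-mix abs) ¬abs
      ... | _ | regular ¬abs  | _ | absorbed abs  = contradiction (absorbs-unmix abs) ¬abs

    restricts : ∀ {n} (p : Weights n) (x : Fin (suc n) → Distribution) →
                combineₑ p (just ∘ x) ≃ just (combineD p x)
    restricts p x with combineₑ p (just ∘ x) | evaluated p (just ∘ x)
    ... | _ | absorbed ((_ , _ , ()) , _)
    ... | _ | regular _ = just (≐.refl {combineD p x})

    extended : OnePointExtension 𝔻
    extended = record
      { combine*         = combineₑ
      ; isConvexAlgebra* = record
        { isEquivalence = Pointwise.isEquivalence ≐-isEquivalence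
        ; cong          = λ {n} {p} {q} → cong {n} {p} {q}
        ; projection    = project
        ; barycenter    = bary
        }
      ; restricts        = restricts
      }

    extended-adherent : ∀ {ξ} → Adheres ξ → Adherent extended ξ
    extended-adherent adheres p =
      ≡-subst (_≃ ⋆) (≡-sym (combine-absorbed (pair p) _
        ((1F , ≉0 (complement p) , ≡-refl) , λ { 0F _ → just adheres ; 1F _ → nothing }))) nothing

    extended-imitates : ∀ {ξ} → ¬ Adheres ξ → ImitatesAt extended w ξ
    extended-imitates {ξ} ¬adheres p = ≡-subst (_≃ just (binary combineD p ξ w))
      (≡-sym (combine-regular (pair p) _ (λ { (_ , adheres) → ¬adheres (All.drop-just (adheres 0F (≉0 p))) })))
      (just (combine-cong {p = pair p} {pair p} {fill ∘ (just ξ ∷ ⋆ ∷ [])} {ξ ∷ w ∷ []} (λ _ → refl) λ { 0F → ≐.refl {ξ} ; 1F → ≐.refl {w} }))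

  -- The three sets of adherence and their extensions.

  everything : ∀ w → AdherenceSet w
  everything w = record
    { Adheres  = λ _ → ⊤
    ; respects = λ _ _ → tt
    ; convex   = λ _ _ _ → tt
    ; face     = λ _ _ _ _ _ → tt
    ; extent   = inj₁ (λ _ → tt)
    }

  empty : ∀ w → AdherenceSet w
  empty w = record
    { Adheres  = λ _ → ⊥
    ; respects = λ _ ()
    -- Weights summing to one have a nonzero entry, and its argument would belong to the empty set.
    ; convex   = λ p x adheres → let (i , pi≉0) = ∃-support p in adheres i pi≉0
    ; face     = λ _ _ ()
    ; extent   = inj₂ λ ()
    }

  singleton : ∀ w → Extremal 𝔻 w → AdherenceSet w
  singleton w extremal = record
    { Adheres  = _≐ w
    ; respects = λ ξ≐η ξ≐w s → trans (sym (ξ≐η s)) (ξ≐w s)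
    ; convex   = λ p x x≐w s → trans (combine-support p {x} {const w} x≐w s) (combine-const p {w} s)
    ; face     = λ p x px≐w i pi≉0 → extremal-support {w} extremal p x px≐w {i} pi≉0
    ; extent   = inj₂ λ ξ≐w → ξ≐w
    }

  module _ (s₀ : S) where

    extension : Behaviour → OnePointExtension 𝔻
    -- Any distribution serves as filler: under `everything` a combination is regular only when `⋆`
    -- has weight zero.
    extension blackHole                    = Extend.extended (everything (dirac s₀))
    extension (imitate w)                  = Extend.extended (empty w)
    extension (imitateAdhering w extremal) = Extend.extended (singleton w extremal)

    extension-follows : ∀ b → extension b Follows b
    extension-follows blackHole   ξ = Extend.extended-adherent (everything (dirac s₀)) {ξ} tt
    extension-follows (imitate w) ξ = Extend.extended-imitates (empty w) {ξ} λ ()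
    extension-follows (imitateAdhering w extremal) =
      (λ ξ → Extend.extended-imitates (singleton w extremal) {ξ}) ,
      Extend.extended-adherent (singleton w extremal) {w} (≐.refl {w})

-- Adherence in an arbitrary one-point extension.

module OnePointExtensionProperties
  {a} (em : ExcludedMiddle a) (ℝ : CompleteOrderedField) (S : Set a) where
  open CompleteOrderedField ℝ
  open Convexity ℝ
  open FreeConvexAlgebra em ℝ S
  open OrderedFieldProperties em ℝ
  open WeightsProperties em ℝ
  open FreeConvexAlgebraProperties em ℝ S
  open Algebra.Properties.Ring ring using (+-cancelʳ; x[y-z]≈xy-xz)
  open Algebra.Properties.CommutativeMonoid.Sum +-commutativeMonoid using (∑-distrib-+)
  module ≃* = IsEquivalence (Pointwise.isEquivalence ≐-isEquivalence)

  infix 4 _≃_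
  _≃_ : Rel (Maybe Distribution) a
  _≃_ = _≃*_ 𝔻

  just≄⋆ : ∀ {u ξ} → u ≃ just ξ → ¬ u ≃ ⋆
  just≄⋆ (just _) ()

  binary-cancelˡ : ∀ p ξ {η ζ} → binary combineD p ξ η ≐ binary combineD p ξ ζ → η ≐ ζ
  binary-cancelˡ p ξ {η} {ζ} eq s = lerp-cancelˡ p
    (trans (sym (binary-mass p ξ η s)) (trans (eq s) (binary-mass p ξ ζ s)))

  -- Write w as p w + (1 - p) w and cancel the second summand.
  binary-fixpoint : ∀ p {ξ w} → binary combineD p ξ w ≐ w → ξ ≐ w
  binary-fixpoint p {ξ} {w} eq = binary-cancelˡ (complement p) w {ξ} {w} λ s →
    trans (sym (binary-comm p ξ w s)) (trans (eq s)
      (trans (sym (binary-idem p {w} s)) (binary-comm p w w s)))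

  t h : OpenUnit
  t = proj₁ third
  h = proj₁ half

  h̄≈h : 1# - value h ≈ value h
  h̄≈h = sym (p̄-unique (proj₂ half))

  -- One third is half of the remaining two thirds, which is what `binary-swap` requires.
  t≈t̄h : value t ≈ (1# - value t) * value h
  t≈t̄h = sym (trans (*-congʳ (sym (p̄-unique (proj₂ third))))
    (trans (distribʳ (value h) (value t) (value t)) (trans (sym (distribˡ (value t) (value h) (value h)))
      (trans (*-congˡ (proj₂ half)) (*-identityʳ (value t))))))

  module Extension (E : OnePointExtension 𝔻) where
    open OnePointExtension E
    private
      module E = ConvexAlgebraProperties em ℝ isConvexAlgebra*

    toward⋆ : OpenUnit → Distribution → Maybe Distribution
    toward⋆ p ξ = binary combine* p (just ξ) ⋆

    restricts-binary : ∀ p ξ η → binary combine* p (just ξ) (just η) ≃ just (binary combineD p ξ η)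
    restricts-binary p ξ η = ≃*.trans
      (IsConvexAlgebra.cong isConvexAlgebra* {p = pair p} {pair p} {just ξ ∷ just η ∷ []} {just ∘ (ξ ∷ η ∷ [])}
        (λ _ → refl) (λ { 0F → ≃*.refl ; 1F → ≃*.refl }))
      (restricts (pair p) (ξ ∷ η ∷ []))

    toward⋆-cong : ∀ {p q ξ η} → value p ≈ value q → ξ ≐ η → toward⋆ p ξ ≃ toward⋆ q η
    toward⋆-cong {p} {q} p≈q ξ≐η = E.binary-cong {p} {q} p≈q (just ξ≐η) nothing

    binary-congʳ : ∀ p x {y z} → y ≃ z → binary combine* p x y ≃ binary combine* p x z
    binary-congʳ p x y≃z = E.binary-cong {p} {p} refl ≃*.refl y≃z

    -- Substituting p ξ + p̄ * for * again and again leaves the value * while the weight on * runs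
    -- through the powers of p̄.
    toward⋆-power : ∀ p ξ → toward⋆ p ξ ≃ ⋆ → ∀ n → toward⋆ (complement (power (complement p) n)) ξ ≃ ⋆
    toward⋆-power p ξ pξ≃⋆ zero    = ≃*.trans
      (toward⋆-cong {complement (complement p)} {p} {ξ} (complement-involutive p) (≐.refl {ξ})) pξ≃⋆
    toward⋆-power p ξ pξ≃⋆ (suc n) = ≃*.trans
      (≃*.sym (E.binary-foldʳ p (complement q) (complement (complement p ⊗ q))
        (trans (complement-involutive (complement p ⊗ q)) (*-congˡ (sym (complement-involutive q))))))
      (≃*.trans (binary-congʳ p (just ξ) (toward⋆-power p ξ pξ≃⋆ n)) pξ≃⋆)
      where q = power (complement p) n

    -- For given q some power of p̄ lies below q̄, so * = r ξ + r̄ * for some r > q. With c r = q,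
    -- the point q ξ + q̄ * equals c (r ξ + r̄ *) + c̄ *, a mixture of * with itself.
    toward⋆-absorbed : ∀ p {ξ} → toward⋆ p ξ ≃ ⋆ → Adherent E ξ
    toward⋆-absorbed p {ξ} pξ≃⋆ q =
      ≃*.trans (≃*.sym (E.binary-foldˡ c r q {just ξ} {⋆} (sym (proj₂ scaled))))
        (≃*.trans (E.binary-cong {c} {c} refl (toward⋆-power p ξ pξ≃⋆ n) (≃*.refl {⋆})) (E.binary-idem c {⋆}))
      where
      small : ∃ λ n → value (power (complement p) n) < value (complement q)
      small = archimedean (complement p) (0< (complement q))

      n = proj₁ small

      r : OpenUnit
      r = complement (power (complement p) n)

      scaled : ∃ λ c → value c * value r ≈ value q
      scaled = quotient (0< q) (<-complement (proj₂ small))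

      c = proj₁ scaled

    -- The path from a non-adherent point and its endpoint.

    module _ {ξ : Distribution} (¬adherent : ¬ Adherent E ξ) where

      -- A single value `⋆` on the path would already make ξ adherent.
      image : ∀ p → ∃ λ ζ → toward⋆ p ξ ≃ just ζ
      image p with toward⋆ p ξ in eq
      ... | just ζ = ζ , ≃*.refl
      ... | ⋆      = contradiction (toward⋆-absorbed p {ξ} (≃*.reflexive eq)) ¬adherent

      γ : OpenUnit → Distribution
      γ p = proj₁ (image p)

      γ-fold : ∀ p q r → 1# - value r ≈ (1# - value p) * (1# - value q) →
               ∀ s → lerp (value p) (mass ξ s) (mass (γ q) s) ≈ mass (γ r) s
      γ-fold p q r r̄≈p̄q̄ s = trans (sym (binary-mass p ξ (γ q) s)) (Pointwise.drop-just
        (≃*.trans (≃*.sym (restricts-binary p ξ (γ q)))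
          (≃*.trans (binary-congʳ p (just ξ) (≃*.sym (proj₂ (image q))))
            (≃*.trans (E.binary-foldʳ p q r r̄≈p̄q̄) (proj₂ (image r))))) s)

      γ-cong : ∀ p q → value p ≈ value q → γ p ≐ γ q
      γ-cong p q p≈q = Pointwise.drop-just (≃*.trans (≃*.sym (proj₂ (image p)))
        (≃*.trans (toward⋆-cong {p} {q} {ξ} p≈q (≐.refl {ξ})) (proj₂ (image q))))

      -- The value at p = 0 of the line taking the values γ h at p = ½ and ξ at p = 1.
      target : S → Carrier
      target s = mass (γ h) s + (mass (γ h) s - mass ξ s)

      target+ξ : ∀ s → target s + mass ξ s ≈ mass (γ h) s + mass (γ h) s
      target+ξ s = trans (+-assoc _ _ _) (+-congˡ (y-x+x (mass ξ s) (mass (γ h) s)))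

      γ-half : ∀ s → mass (γ h) s ≈ lerp (value h) (mass ξ s) (target s)
      γ-half s = sym (trans (+-congˡ (*-congʳ h̄≈h)) (trans (sym (distribˡ (value h) _ _))
        (trans (*-congˡ (trans (+-comm _ _) (target+ξ s)))
          (trans (distribˡ (value h) _ _) (trans (sym (distribʳ (mass (γ h) s) (value h) (value h)))
            (trans (*-congʳ (proj₂ half)) (*-identityˡ _)))))))

      fold-weight : ∀ c {p q} → value c * (1# - value p) ≈ 1# - value q →
                    1# - value q ≈ (1# - value (complement c)) * (1# - value p)
      fold-weight c cp̄≈q̄ = trans (sym cp̄≈q̄) (*-congʳ (sym (complement-involutive c)))

      -- The formula holds at ½ by the choice of `target`. For p > ½, mixing ξ into `γ h` gives
      -- `γ p`; for p < ½, mixing ξ into `γ p` gives `γ h`, and cancellation solves for `γ p`.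
      γ-lerp : ∀ p s → mass (γ p) s ≈ lerp (value p) (mass ξ s) (target s)
      γ-lerp p s = go (compare (value (complement p)) (value (complement h)))
        where
        go : value (complement p) < value (complement h) ⊎
             value (complement p) ≈ value (complement h) ⊎
             value (complement h) < value (complement p) →
             mass (γ p) s ≈ lerp (value p) (mass ξ s) (target s)
        go (inj₁ p̄<h̄) =
          trans (sym (γ-fold (complement c) h p eq s))
            (trans (+-congˡ (*-congˡ (γ-half s))) (lerp-fold {r = value p} (mass ξ s) (target s) eq))
          where
          scaled = quotient (0< (complement p)) p̄<h̄
          c = proj₁ scaled
          eq = fold-weight c {h} {p} (proj₂ scaled)
        go (inj₂ (inj₁ p̄≈h̄)) =
          trans (γ-cong p h p≈h s)
            (trans (γ-half s) (+-cong (*-congʳ (sym p≈h)) (*-congʳ (sym p̄≈h̄))))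
          where
          p≈h : value p ≈ value h
          p≈h = trans (sym (complement-involutive p)) (trans (+-congˡ (-‿cong p̄≈h̄)) (complement-involutive h))
        go (inj₂ (inj₂ h̄<p̄)) = lerp-cancelˡ (complement c)
          (trans (γ-fold (complement c) p h eq s)
            (trans (γ-half s) (sym (lerp-fold {r = value h} (mass ξ s) (target s) eq))))
          where
          scaled = quotient (0< (complement h)) h̄<p̄
          c = proj₁ scaled
          eq = fold-weight c {p} {h} (proj₂ scaled)

      target-nonNeg : ∀ s → 0# ≤ target s
      target-nonNeg s = lerp-nonNeg⁻ (nonNeg ξ s) (λ p → ≤-respʳ (γ-lerp p s) (nonNeg (γ p) s))

      sum≈0 : ∀ {s} → s ∉ cover (γ h) → target s + mass ξ s ≈ 0#
      sum≈0 s∉ = trans (target+ξ _) (trans (+-cong (outside (γ h) s∉) (outside (γ h) s∉)) (+-identityˡ 0#))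

      -- There `target` and ξ are nonnegative with sum zero, so both vanish. Hence the cover of
      -- `γ h` serves for both.
      target-outside : ∀ {s} → s ∉ cover (γ h) → target s ≈ 0#
      target-outside {s} s∉ = ≤-antisym
        (≤-respˡ (+-identityʳ _) (≤-respʳ (sum≈0 s∉) (+-mono-≤ ≤-refl (nonNeg ξ s)))) (target-nonNeg s)

      ξ-outside : ∀ {s} → s ∉ cover (γ h) → mass ξ s ≈ 0#
      ξ-outside {s} s∉ = trans (sym (+-identityˡ _)) (trans (+-congʳ (sym (target-outside s∉))) (sum≈0 s∉))

      -- The sum of `target` and ξ is twice `γ h` and has total two, of which ξ contributes one.
      target-total : sumOver (cover (γ h)) target ≈ 1#
      target-total = +-cancelʳ 1# _ _ (trans (+-congˡ (sym ξ-total))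
        (trans (sym (∑-distrib-+ (target ∘ at) (mass ξ ∘ at)))
          (trans (sum-cong-≋ (target+ξ ∘ at))
            (trans (∑-distrib-+ (mass (γ h) ∘ at) (mass (γ h) ∘ at))
              (+-cong (total-1 (γ h)) (total-1 (γ h)))))))
        where
        at = lookup (cover (γ h))
        ξ-total : sumOver (cover (γ h)) (mass ξ) ≈ 1#
        ξ-total = trans (sumOver-cover (mass ξ) (cover (γ h)) (cover ξ) (unique (γ h)) (unique ξ)
          ξ-outside (outside ξ)) (total-1 ξ)

      imitated : Distribution
      imitated = record
        { mass    = target
        ; nonNeg  = target-nonNeg
        ; cover   = cover (γ h)
        ; unique  = unique (γ h)
        ; outside = target-outside
        ; total-1 = target-total
        }

      imitates : ImitatesAt E imitated ξ
      imitates p = ≃*.trans (proj₂ (image p))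
        (just (λ s → trans (γ-lerp p s) (sym (binary-mass p ξ imitated s))))

    -- Comparison of imitating and adherent points.

    private
      𝔻-swap : ∀ ξ η w → binary combineD t ξ (binary combineD h η w) ≐ binary combineD t η (binary combineD h ξ w)
      𝔻-swap ξ η w = binary-swap t h {ξ} {η} {w} t≈t̄h

    imitates-mix : ∀ {w η} p ξ → ImitatesAt E w η →
      binary combine* p (just ξ) (toward⋆ h η) ≃ just (binary combineD p ξ (binary combineD h η w))
    imitates-mix p ξ imitates = ≃*.trans (binary-congʳ p (just ξ) (imitates h)) (restricts-binary p ξ _)

    -- Swapping ξ and η inside `E` evaluates one element once through v and once through w. Swapping
    -- back inside `𝔻` leaves expressions differing only in v and w, and cancelling η and ξ isolates
    -- these.
    imitated-unique : ∀ {ξ η v w} → ImitatesAt E v ξ → ImitatesAt E w η → v ≐ w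
    imitated-unique {ξ} {η} {v} {w} imitates-v imitates-w =
      binary-cancelˡ h ξ {v} {w} (binary-cancelˡ t η {binary combineD h ξ v} {binary combineD h ξ w} λ s →
        trans (Pointwise.drop-just (≃*.trans (≃*.sym (imitates-mix t η imitates-v))
                (≃*.trans (E.binary-swap t h t≈t̄h) (imitates-mix t ξ imitates-w))) s)
              (𝔻-swap ξ η w s))

    -- The same swap with ξ absorbed: one side becomes ⅓ η + ⅔ w, the other ⅓ η + ⅔ (½ ξ + ½ w), so
    -- mixing ξ into w does not move w.
    adherent⇒imitated : ∀ {ξ η w} → Adherent E ξ → ImitatesAt E w η → ξ ≐ w
    adherent⇒imitated {ξ} {η} {w} adherent imitates =
      binary-fixpoint h {ξ} {w} (binary-cancelˡ t η {binary combineD h ξ w} {w} λ s →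
        trans (sym (𝔻-swap ξ η w s))
          (Pointwise.drop-just (≃*.trans (≃*.sym (imitates-mix t ξ imitates))
            (≃*.trans (E.binary-swap t h t≈t̄h)
              (≃*.trans (binary-congʳ t (just η) (adherent h)) (imitates t)))) s))

    adherent-cong : ∀ {ξ η} → ξ ≐ η → Adherent E ξ → Adherent E η
    adherent-cong {ξ} {η} ξ≐η adherent p = ≃*.trans
      (≃*.sym (toward⋆-cong {p} {p} {ξ} {η} refl ξ≐η)) (adherent p)

    absorbed-inner : ∀ p ξ {v} → binary combine* p (just ξ) v ≃ ⋆ → v ≃ ⋆
    absorbed-inner p ξ {⋆}      _    = nothing
    absorbed-inner p ξ {just ζ} pv≃⋆ = contradiction pv≃⋆ (just≄⋆ (restricts-binary p ξ ζ))

    -- Reassociate ½ (p ξ + p̄ η) + ½ * = * as r ξ + r̄ (s η + s̄ *) = *. The inner point cannot be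
    -- a distribution, so it is *, and ξ is absorbed at the one weight r, which suffices.
    adherent-faceˡ : ∀ p ξ η → Adherent E (binary combineD p ξ η) → Adherent E ξ
    adherent-faceˡ p ξ η adherent = toward⋆-absorbed r {ξ}
      (≃*.trans (binary-congʳ r (just ξ) (≃*.sym (absorbed-inner r ξ chain))) chain)
      where
      r : OpenUnit
      r = h ⊗ p

      hp̄<r̄ : value h * (1# - value p) < 1# - value r
      hp̄<r̄ = ≤-<-trans (≤-reflexive (trans (x[y-z]≈xy-xz (value h) 1# (value p)) (+-congʳ (*-identityʳ _))))
               (+-monoˡ-< (- value r) (<1 h))

      -- This s matches the coefficient of η on both sides, as `binary-assoc` demands.
      scaled : ∃ λ s → value s * (1# - value r) ≈ value h * (1# - value p)
      scaled = quotient (0< (h ⊗ complement p)) hp̄<r̄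

      s : OpenUnit
      s = proj₁ scaled

      chain : binary combine* r (just ξ) (toward⋆ s η) ≃ ⋆
      chain = ≃*.trans
        (≃*.sym (E.binary-assoc h p r s {just ξ} {just η} {⋆} refl (trans (*-comm _ _) (proj₂ scaled))))
        (≃*.trans (E.binary-cong {h} {h} refl (restricts-binary p ξ η) (≃*.refl {⋆})) (adherent h))

    adherent-faceʳ : ∀ p ξ η → Adherent E (binary combineD p ξ η) → Adherent E η
    adherent-faceʳ p ξ η adherent = adherent-faceˡ (complement p) η ξ
      (adherent-cong {binary combineD p ξ η} {binary combineD (complement p) η ξ} (binary-comm p ξ η) adherent)

    -- Reduction of all combinations to binary ones with `⋆`.

    combine-all-just : ∀ ξ₀ {n} (p : Weights n) x → (∀ i → weight p i ≉ 0# → is-just (x i) ≡ true) →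
                       combine* p x ≃ just (combineD p (fromMaybe ξ₀ ∘ x))
    combine-all-just ξ₀ p x all-just = ≃*.trans
      -- The default `ξ₀` replaces `⋆` only at indices of weight zero.
      (E.combine-support p {x} {just ∘ fromMaybe ξ₀ ∘ x} (λ i pi≉0 → filled (x i) (all-just i pi≉0)))
      (restricts p (fromMaybe ξ₀ ∘ x))
      where
      filled : ∀ v → is-just v ≡ true → v ≃ just (fromMaybe ξ₀ v)
      filled (just _) _ = ≃*.refl

    combine-no-just : ∀ {n} (p : Weights n) x → (∀ i → weight p i ≉ 0# → is-just (x i) ≡ false) →
                      combine* p x ≃ ⋆
    combine-no-just p x no-just = ≃*.trans
      (E.combine-support p {x} {const ⋆} (λ i pi≉0 → starred (x i) (no-just i pi≉0)))
      (E.combine-const p {⋆})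
      where
      starred : ∀ v → is-just v ≡ false → v ≃ ⋆
      starred ⋆ _ = nothing

    -- Splitting the indices by `is-just` gathers the distributions into one distribution and all
    -- occurrences of `⋆` into one `⋆`.
    combine-toward⋆ : ∀ ξ₀ {n} (p : Weights n) x c (sum≈c : sum (restrict (is-just ∘ x) (weight p)) ≈ value c) →
      combine* p x ≃ toward⋆ c (combineD (conditional p (is-just ∘ x) c sum≈c) (fromMaybe ξ₀ ∘ x))
    combine-toward⋆ ξ₀ p x c sum≈c = ≃*.trans (E.combine-split p D c sum≈c x)
      (E.binary-cong {c} {c} refl
        (combine-all-just ξ₀ (conditional p D c sum≈c) x (λ i → conditional-support p D c sum≈c))
        (combine-no-just q x (λ i qi≉0 →
          not-injective (conditional-support p (not ∘ D) (complement c) (sum-complement p D sum≈c) qi≉0))))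
      where
      D : Fin _ → Bool
      D = is-just ∘ x

      q : Weights _
      q = conditional p (not ∘ D) (complement c) (sum-complement p D sum≈c)

  -- Uniqueness of the extension with a given behaviour.

  module _ (ξ₀ : Distribution) (E F : OnePointExtension 𝔻) where
    private
      module E = Extension E
      module F = Extension F
    open OnePointExtension

    -- The total weight m of the distributions among the arguments decides: for m = 0 the value is
    -- `⋆`, for m = 1 it is computed in `𝔻`, and otherwise `combine-toward⋆` applies.
    ≅-toward⋆ : (∀ p ξ → E.toward⋆ p ξ ≃ F.toward⋆ p ξ) → E ≅ F
    ≅-toward⋆ agree {n} p x = go (decide (m ≈ 0#)) (decide (m ≈ 1#))
      where
      D : Fin (suc n) → Bool
      D = is-just ∘ x

      m : Carrier
      m = sum (restrict D (weight p))

      m̄ : sum (restrict (not ∘ D) (weight p)) ≈ 1# - m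
      m̄ = sum-complement p D refl

      m≤1 : m ≤ 1#
      m≤1 = ≤-respˡ (+-identityʳ m) (≤-respʳ (trans (+-congˡ m̄) (x+[y-x] m 1#))
              (+-mono-≤ ≤-refl (sum-nonNeg (restrict-nonNeg (not ∘ D) (0≤ p)))))

      go : Dec (m ≈ 0#) → Dec (m ≈ 1#) → combine* E p x ≃ combine* F p x
      go (yes m≈0) _ = ≃*.trans (E.combine-no-just p x no-just) (≃*.sym (F.combine-no-just p x no-just))
        where
        no-just : ∀ i → weight p i ≉ 0# → D i ≡ false
        no-just i = sum-restrict≈0 p D m≈0
      go (no _) (yes m≈1) = ≃*.trans (E.combine-all-just ξ₀ p x all-just)
                              (≃*.sym (F.combine-all-just ξ₀ p x all-just))
        where
        m̄≈0 : sum (restrict (not ∘ D) (weight p)) ≈ 0#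
        m̄≈0 = trans m̄ (trans (+-congˡ (-‿cong m≈1)) (-‿inverseʳ 1#))

        all-just : ∀ i → weight p i ≉ 0# → D i ≡ true
        all-just i pi≉0 = not-injective (sum-restrict≈0 p (not ∘ D) m̄≈0 pi≉0)
      go (no m≉0) (no m≉1) = ≃*.trans (E.combine-toward⋆ ξ₀ p x c refl)
        (≃*.trans (agree c _) (≃*.sym (F.combine-toward⋆ ξ₀ p x c refl)))
        where
        c : OpenUnit
        c = record
          { value = m
          ; 0<    = sum-nonNeg (restrict-nonNeg D (0≤ p)) , m≉0 ∘ sym
          ; <1    = m≤1 , m≉1
          }

    follows-unique : ∀ b → E Follows b → F Follows b → E ≅ F
    follows-unique b followsE followsF = ≅-toward⋆ (agree b followsE followsF)
      where
      agree : ∀ b → E Follows b → F Follows b → ∀ p ξ → E.toward⋆ p ξ ≃ F.toward⋆ p ξ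
      agree blackHole   e f p ξ = ≃*.trans (e ξ p) (≃*.sym (f ξ p))
      agree (imitate w) e f p ξ = ≃*.trans (e ξ p) (≃*.sym (f ξ p))
      agree (imitateAdhering w _) (e , e′) (f , f′) p ξ with em {ξ ≐ w}
      ... | no  ξ≐̸w = ≃*.trans (e ξ ξ≐̸w p) (≃*.sym (f ξ ξ≐̸w p))
      ... | yes ξ≐w = ≃*.trans (E.adherent-cong {w} {ξ} w≐ξ e′ p) (≃*.sym (F.adherent-cong {w} {ξ} w≐ξ f′ p))
        where
        w≐ξ : w ≐ ξ
        w≐ξ s = sym (ξ≐w s)

  -- Every extension has one of the three behaviours.

  follows-some : ∀ E → ∃ λ b → E Follows b
  follows-some E with em {∀ ξ → Adherent E ξ}
  ... | yes all-adherent = blackHole , all-adherent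
  ... | no ¬all-adherent with em {∃ λ ξ → ¬ Adherent E ξ}
  ...   | no  none       = contradiction
          (λ ξ → Dec.decidable-stable em (λ ¬adherent → none (ξ , ¬adherent))) ¬all-adherent
  ...   | yes (η , ¬η)   = go em
    where
    open Extension E

    w : Distribution
    w = imitated {η} ¬η

    imitates-w : ∀ {ξ} → ¬ Adherent E ξ → ImitatesAt E w ξ
    imitates-w {ξ} ¬ξ p = ≃*.trans (imitates {ξ} ¬ξ p) (just (combine-cong
      {p = pair p} {pair p} {ξ ∷ imitated {ξ} ¬ξ ∷ []} {ξ ∷ w ∷ []} (λ _ → refl)
      (λ { 0F → ≐.refl {ξ} ; 1F → imitated-unique {ξ} {η} (imitates {ξ} ¬ξ) (imitates {η} ¬η) })))

    adherent⇒w : ∀ {ξ} → Adherent E ξ → ξ ≐ w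
    adherent⇒w {ξ} adherent = adherent⇒imitated {ξ} {η} {w} adherent (imitates {η} ¬η)

    -- Every adherent point equals w, so it only remains to ask whether w itself adheres.
    go : Dec (Adherent E w) → ∃ λ b → E Follows b
    go (yes w-adherent) = imitateAdhering w extremal ,
      (λ ξ ξ≐̸w → imitates-w {ξ} (λ ξ-adherent → ξ≐̸w (adherent⇒w {ξ} ξ-adherent))) , w-adherent
      where
      extremal : Extremal 𝔻 w
      -- A mixture equal to w adheres; by the face property both its points adhere, and so both
      -- equal w.
      extremal p ξ ζ eq =
        adherent⇒w {ξ} (adherent-faceˡ p ξ ζ mixed) , adherent⇒w {ζ} (adherent-faceʳ p ξ ζ mixed)
        where
        mixed : Adherent E (binary combineD p ξ ζ)
        mixed = adherent-cong {w} {binary combineD p ξ ζ} (λ s → sym (eq s)) w-adherent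
    go (no ¬w-adherent) = imitate w , λ ξ → imitates-w {ξ} λ ξ-adherent →
      ¬w-adherent (adherent-cong {ξ} {w} (adherent⇒w {ξ} ξ-adherent) ξ-adherent)

  -- Distinctness of the extensions.

  follows-resp-≅ : ∀ {E F} → E ≅ F → ∀ b → E Follows b → F Follows b
  follows-resp-≅ E≅F blackHole   follows ξ p = ≃*.trans (≃*.sym (E≅F (pair p) _)) (follows ξ p)
  follows-resp-≅ E≅F (imitate w) follows ξ p = ≃*.trans (≃*.sym (E≅F (pair p) _)) (follows ξ p)
  follows-resp-≅ E≅F (imitateAdhering w _) (imitates , adherent) =
    (λ ξ ξ≐̸w p → ≃*.trans (≃*.sym (E≅F (pair p) _)) (imitates ξ ξ≐̸w p)) ,
    (λ p → ≃*.trans (≃*.sym (E≅F (pair p) _)) (adherent p))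

  ¬adherent-imitates : ∀ (E : OnePointExtension 𝔻) {ξ w} → Adherent E ξ → ¬ ImitatesAt E w ξ
  ¬adherent-imitates E adherent imitates = just≄⋆ (imitates h) (adherent h)

  -- A distribution other than w would both adhere and imitate w. So w is the only distribution, and
  -- any two point masses coincide.
  adhering-everywhere : ∀ E {w extremal} → E Follows blackHole → E Follows imitateAdhering w extremal →
                        ∀ (s t : S) → s ≡ t
  adhering-everywhere E {w} adherent (imitates , _) s t =
    dirac-injective {s} {t} (λ u → trans (≐w (dirac s) u) (sym (≐w (dirac t) u)))
    where
    ≐w : ∀ ξ → ξ ≐ w
    ≐w ξ = Dec.decidable-stable em (λ ξ≐̸w → ¬adherent-imitates E {ξ} {w} (adherent ξ) (imitates ξ ξ≐̸w))

  -- Behaviours of different kinds clash at some point that would adhere and imitate, apart from the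
  -- pairs in `Coincide`. Within one kind, w is recovered by `imitated-unique` or as the adherent
  -- point.
  follows-determines : ∀ E b c → E Follows b → E Follows c → ¬ Coincide b c → b ≈ᵇ c
  follows-determines E blackHole blackHole _ _ _ = blackHole
  follows-determines E blackHole (imitate w) adherent imitates _ =
    contradiction (imitates w) (¬adherent-imitates E {w} {w} (adherent w))
  follows-determines E (imitate v) blackHole imitates adherent _ =
    contradiction (imitates v) (¬adherent-imitates E {v} {v} (adherent v))
  follows-determines E blackHole (imitateAdhering w extremal) b c distinct =
    contradiction (left (adhering-everywhere E {w} {extremal} b c)) distinct
  follows-determines E (imitateAdhering v extremal) blackHole b c distinct =
    contradiction (right (adhering-everywhere E {v} {extremal} c b)) distinct
  follows-determines E (imitate v) (imitate w) imitates-v imitates-w _ =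
    imitate (Extension.imitated-unique E {v} {v} (imitates-v v) (imitates-w v))
  follows-determines E (imitate v) (imitateAdhering w _) imitates (_ , adherent) _ =
    contradiction (imitates w) (¬adherent-imitates E {w} {v} adherent)
  follows-determines E (imitateAdhering v _) (imitate w) (_ , adherent) imitates _ =
    contradiction (imitates v) (¬adherent-imitates E {v} {w} adherent)
  follows-determines E (imitateAdhering v _) (imitateAdhering w _) (_ , adherent) (imitates , _) _ =
    imitateAdhering (Dec.decidable-stable em (λ v≐̸w →
      ¬adherent-imitates E {v} {w} adherent (imitates v v≐̸w)))

theorem5p1 : ∀ {a} (em : ExcludedMiddle a) (ℝ : CompleteOrderedField) (S : Set a) → S →
    let open Convexity ℝ
        open FreeConvexAlgebra em ℝ S in
    ∃ λ (extension : Behaviour → OnePointExtension 𝔻) →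
      (∀ b → extension b Follows b) ×
      (∀ (E : OnePointExtension 𝔻) → ∃ λ b → E ≅ extension b) ×
      (∀ b c → ¬ b ≈ᵇ c → ¬ Coincide b c → ¬ extension b ≅ extension c)
theorem5p1 em ℝ S s₀ =
    extension s₀
  , extension-follows s₀
  , (λ E → let (b , E-follows) = follows-some E in
      b , follows-unique (dirac s₀) E (extension s₀ b) b E-follows (extension-follows s₀ b))
  -- Equal extensions would make the second follow both behaviours, which then agree.
  , λ b c b≉c distinct b≅c → b≉c (follows-determines (extension s₀ c) b c
      (follows-resp-≅ {extension s₀ b} {extension s₀ c} b≅c b (extension-follows s₀ b))
      (extension-follows s₀ c) distinct)
  where
  open FreeConvexAlgebraProperties em ℝ S
  open OnePointExtensionProperties em ℝ S
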